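{- Let $\mathcal{C}$ be a non-degenerate $[n,k]_{q^m/q}$ code such that $\mathcal{C}^\perp$ is non-degenerate, let $U_{\mathcal{C}}$ be an associated system, and let $0<\varepsilon_{U_{\mathcal{C}}}(t_1)=\varepsilon_1<\dots<\varepsilon_{U_{\mathcal{C}}}(t_{s-1})=\varepsilon_{s-1}<\varepsilon_{U_{\mathcal{C}}}(k)=n-k$ be the sequence of maximum non-zero defects with respect to $U_{\mathcal{C}}$, and set $t_0=0$, $\varepsilon_0=0$, $t_s=k$, $\varepsilon_s=n-k$. Then: (1) for every $r\in\{1,\dots,k\}$, if $t_i\le k-r<t_{i+1}$, then $d_r(\mathcal{C})=n-(k-r)-\varepsilon_i$; consequently $\{n+1-d_r(\mathcal{C}):1\le r\le k\}=\bigcup_{i=0}^{s-1}I_i$ with $I_i=\{1+\varepsilon_i+t_i,2+\varepsilon_i+t_i,\dots,t_{i+1}+\varepsilon_i\}$; (2) for every $r\in\{1,\dots,n-k\}$, if $j\in[s]$ is such that $\varepsilon_{j-1}<r\le\varepsilon_j$, then $d_r(\mathcal{C}^\perp)=r+t_j$; consequently $\{d_r(\mathcal{C}^\perp):1\le r\le n-k\}=\bigcup_{j=1}^sJ_j$ with $J_j=\{1+\varepsilon_{j-1}+t_j,\dots,\varepsilon_j+t_j\}$; (3) $\{d_r(\mathcal{C}^\perp):1\le r\le n-k\}=\{1,\dots,n\}\setminus\{n+1-d_r(\mathcal{C}):1\le r\le k\}$.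
   Context: An $[n,k]_{q^m/q}$ code is a $k$-dim $\mathbb{F}_{q^m}$-subspace of $\mathbb{F}_{q^m}^n$ with the rank metric; $\mathcal{C}^\perp$ is the dual w.r.t. the standard bilinear form. Non-degenerate: columns of a generator matrix are $\mathbb{F}_q$-linearly independent. For non-degenerate $\mathcal{C}$ with generator matrix $G$, an associated system $U_{\mathcal{C}}\subseteq\mathbb{F}_{q^m}^k$ is the $\mathbb{F}_q$-span of the columns of $G$ (an $n$-dim $\mathbb{F}_q$-subspace spanning $\mathbb{F}_{q^m}^k$). The $r$-th generalized rank weight is $d_r(\mathcal{C})=n-\max\{\dim_{\mathbb{F}_q}(U_{\mathcal{C}}\cap T): T \text{ an } \mathbb{F}_{q^m}\text{ -subspace of codimension } r \text{ in } \mathbb{F}_{q^m}^k\}$ (and similarly for $\mathcal{C}^\perp$ with $U_{\mathcal{C}^\perp}\subseteq\mathbb{F}_{q^m}^{n-k}$). For an $\mathbb{F}_q$-subspace $U$ of $\mathbb{F}_{q^m}^k$ and $\mathbb{F}_{q^m}$-subspace $T$: $\varepsilon_U(T)=\dim_{\mathbb{F}_q}(U\cap T)-\dim_{\mathbb{F}_{q^m}}T$; $\varepsilon_U(r)=\max\{\varepsilon_U(T):\dim T=r\}$. For $U$ of dimension $n$ spanning $\mathbb{F}_{q^m}^k$, $0=\varepsilon_U(0)\le\dots\le\varepsilon_U(k)=n-k$; if $\varepsilon_1<\dots<\varepsilon_s$ are the distinct positive values and $t_i=\min\{r:\varepsilon_U(r)=\varepsilon_i\}$, then $\varepsilon_U(t_1)<\dots<\varepsilon_U(t_s)$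 is the sequence of maximum non-zero defects. -}

module Defs where

open import Level using (0ℓ)
open import Algebra.Bundles using (CommutativeRing)
open import Data.Nat using (ℕ; zero; suc; _+_; _∸_; _≤_; _<_)
open import Data.Fin using (Fin; zero; suc)
open import Data.Product using (Σ; ∃; _×_; _,_)
open import Relation.Binary.PropositionalEquality using (_≡_)
open import Relation.Nullary using (¬_)

record IsField (R : CommutativeRing 0ℓ 0ℓ) : Set where
  module R = CommutativeRing R
  field
    0≉1     : ¬ (R.0# R.≈ R.1#)
    inverse : ∀ x → ¬ (x R.≈ R.0#) → Σ R.Carrier (λ y → (x R.* y) R.≈ R.1#)

module _ (R : CommutativeRing 0ℓ 0ℓ) where
  private module R = CommutativeRing R
  ∑ : ∀ {d} → (Fin d → R.Carrier) → R.Carrier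
  ∑ {zero}  f = R.0#
  ∑ {suc d} f = f zero R.+ ∑ (λ i → f (suc i))

record Ext (q m : ℕ) : Set₁ where
  field
    Fq    : CommutativeRing 0ℓ 0ℓ
    Fq-field : IsField Fq
    K     : CommutativeRing 0ℓ 0ℓ
    K-field : IsField K
  module F = CommutativeRing Fq
  module Kr = CommutativeRing K
  field
    enum      : Fin q → F.Carrier
    enum-surj : ∀ a → Σ (Fin q) (λ i → enum i F.≈ a)
    enum-inj  : ∀ i j → enum i F.≈ enum j → i ≡ j
    ι      : F.Carrier → Kr.Carrier
    ι-cong : ∀ {a b} → a F.≈ b → ι a Kr.≈ ι b
    ι-+    : ∀ a b → ι (a F.+ b) Kr.≈ (ι a Kr.+ ι b)
    ι-*    : ∀ a b → ι (a F.* b) Kr.≈ (ι a Kr.* ι b)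
    ι-1    : ι F.1# Kr.≈ Kr.1#
    basis        : Fin m → Kr.Carrier
    basis-indep  : ∀ (a : Fin m → F.Carrier) →
                   ∑ K (λ i → ι (a i) Kr.* basis i) Kr.≈ Kr.0# → ∀ i → a i F.≈ F.0#
    basis-span   : ∀ x → Σ (Fin m → F.Carrier) (λ a → x Kr.≈ ∑ K (λ i → ι (a i) Kr.* basis i))

module Over {q m : ℕ} (E : Ext q m) where
  open Ext E

  V : ℕ → Set
  V k = Fin k → Kr.Carrier

  _≋_ : ∀ {k} → V k → V k → Set
  x ≋ y = ∀ j → x j Kr.≈ y j

  𝟘 : ∀ {k} → V k
  𝟘 j = Kr.0#

  combK : ∀ {d k} → (Fin d → Kr.Carrier) → (Fin d → V k) → V k
  combK a v j = ∑ K (λ i → a i Kr.* v i j)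

  combF : ∀ {d k} → (Fin d → F.Carrier) → (Fin d → V k) → V k
  combF a v j = ∑ K (λ i → ι (a i) Kr.* v i j)

  IndepK : ∀ {d k} → (Fin d → V k) → Set
  IndepK v = ∀ a → combK a v ≋ 𝟘 → ∀ i → a i Kr.≈ Kr.0#

  IndepF : ∀ {d k} → (Fin d → V k) → Set
  IndepF v = ∀ a → combF a v ≋ 𝟘 → ∀ i → a i F.≈ F.0#

  SpanK : ∀ {d k} → (Fin d → V k) → V k → Set
  SpanK v x = Σ (Fin _ → Kr.Carrier) (λ a → x ≋ combK a v)

  SpanF : ∀ {d k} → (Fin d → V k) → V k → Set
  SpanF v x = Σ (Fin _ → F.Carrier) (λ a → x ≋ combF a v)

  HasDimF : ∀ {k} → (V k → Set) → ℕ → Set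
  HasDimF {k} S d = Σ (Fin d → V k) (λ b → (∀ i → S (b i)) × IndepF b × (∀ x → S x → SpanF b x))

  Inter : ∀ {n r k} → (Fin n → V k) → (Fin r → V k) → V k → Set
  Inter u B x = SpanF u x × SpanK B x

  -- F_{q^m}-subspaces T of F_{q^m}^k of dimension r are exactly the spans of
  -- F_{q^m}-linearly independent families B : Fin r → V k.

  -- ε_U(r) = e, where U = ⟨u⟩_{F_q} ⊆ F_{q^m}^k (u : n vectors):
  -- the maximum over T with dim T = r of dim_{F_q}(U ∩ T) − r equals e.
  MaxDefect : ∀ {n k} → (Fin n → V k) → ℕ → ℕ → Set
  MaxDefect {n} {k} u r e =
    Σ (Fin r → V k) (λ B → IndepK B × HasDimF (Inter u B) (r + e))
    × (∀ (B : Fin r → V k) → IndepK B → ∀ M → HasDimF (Inter u B) M → M ≤ r + e)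

  -- d_r = d for the system U = ⟨u⟩_{F_q} ⊆ F_{q^m}^k of dimension n:
  -- d = n − max{dim_{F_q}(U ∩ T) : T of codimension r (i.e. dim k − r)}.
  GenRankWeight : ∀ {n k} → (Fin n → V k) → ℕ → ℕ → Set
  GenRankWeight {n} {k} u r d =
    Σ ℕ (λ M → d ≡ n ∸ M
      × Σ (Fin (k ∸ r) → V k) (λ B → IndepK B × HasDimF (Inter u B) M)
      × (∀ (B : Fin (k ∸ r) → V k) → IndepK B → ∀ M' → HasDimF (Inter u B) M' → M' ≤ M))

  cols : ∀ {k n} → (Fin k → Fin n → Kr.Carrier) → Fin n → V k
  cols G j i = G i j

  ⟪_,_⟫ : ∀ {n} → V n → V n → Kr.Carrier
  ⟪ x , y ⟫ = ∑ K (λ j → x j Kr.* y j)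

  InDual : ∀ {k n} → (Fin k → V n) → V n → Set
  InDual G x = ∀ c → SpanK G c → ⟪ x , c ⟫ Kr.≈ Kr.0#

  -- G is a generator matrix of a k-dimensional code (rows independent)
  -- which is non-degenerate (columns F_q-linearly independent).
  NonDegGen : ∀ {k n} → (Fin k → V n) → Set
  NonDegGen G = IndepK G × IndepF (cols G)

  GenOfDual : ∀ {k k' n} → (Fin k → V n) → (Fin k' → V n) → Set
  GenOfDual G H = IndepK H × (∀ x → (SpanK H x → InDual G x) × (InDual G x → SpanK H x))

{-# OPTIONS --safe #-}
module Submission where

-- For A ⊆ F_q^n put ρ(A) = dim_K ⟨G A⟩ and def(A) = dim A − ρ(A). Then ε_U(l) is the maximum of def(A)
-- over ρ(A) ≤ l; it is nondecreasing in l because the columns of G span K^k, and so equals ε_i on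
-- [t_i , t_{i+1}), which gives (1). The analogous rank for H satisfies
-- dim_K ⟨H A^⊥⟩ = (n − k) − def(A), hence d_r(C^⊥) = min { dim A : def(A) ≥ r }. A minimiser needs
-- ρ(A) ≥ t_j when ε_{j-1} < r, and r + t_j vectors of U ∩ T, with T of dimension t_j and defect ε_j,
-- attain the bound, which gives (2). For (3), the intervals I_0, J_1, I_1, J_2, … tile {1,…,n}.

open import Defs
open import Level using (0ℓ)
open import Algebra.Bundles using (CommutativeRing)
open import Data.Empty using (⊥)
open import Data.Fin using (Fin; zero; suc; punchIn; punchOut; _↑ʳ_; _≟_; combine; remQuot)
open import Data.Fin.Properties using (any?; all?; punchIn-punchOut; remQuot-combine)
open import Data.Nat using (ℕ; zero; suc; _+_; _∸_; _≤_; _<_; z≤n; s≤s; s≤s⁻¹; _≤?_; _≤′_; ≤′-refl; ≤′-step) renaming (_*_ to _·_)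
import Data.Nat.Properties as ℕ
open import Data.Nat.Solver using (module +-*-Solver)
open import Data.Product using (Σ; ∃; _×_; _,_; proj₁; proj₂)
open import Data.Product.Function.NonDependent.Propositional using (_×-⇔_)
open import Data.Vec.Functional using (_∷_; insertAt)
open import Data.Vec.Functional.Properties using (insertAt-lookup; insertAt-punchIn)
open import Function using (_∘_)
open import Function.Bundles using (_⇔_; mk⇔)
open import Function.Construct.Composition using (_⇔-∘_)
open import Function.Construct.Identity using (⇔-id)
open import Function.Construct.Symmetry using (⇔-sym)
open import Function.Related.TypeIsomorphisms using (¬-cong-⇔)
open import Relation.Binary.Definitions using (Tri; tri<; tri≈; tri>)
open import Relation.Binary.PropositionalEquality as ≡ using (_≡_)
open import Relation.Nullary using (¬_; Dec; yes; no; ¬?; contradiction; decidable-stable)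
open import Relation.Nullary.Decidable using (map′)

-- Dropping vectors, adding a column and dualising control the dimension of U ∩ T only from below,
-- whereas defects and weights are defined by exact dimensions. The argument therefore runs on the
-- lower bounds `Meets`, and `meets⇒hasDim` with `attain` returns to exact dimensions. Of the
-- duality formula only one inequality is proved, for `G` and `H` such that every vector orthogonal
-- to the rows of `H` is a codeword of `G`. For a code and its dual this condition holds both ways,
-- so exchanging the two supplies the opposite inequality. The hypothesis on the values of `ε`
-- speaks only of attained maxima, and a maximum over subspaces is not computed. That it cannot fail
-- to exist is enough, because the bounds derived from it are inequalities of natural numbers, hence
-- stable under double negation.

-- Finite sums over a commutative ring.

module Sums (R : CommutativeRing 0ℓ 0ℓ) where
  open CommutativeRing R hiding (zero) renaming (_+_ to _⊕_)
  open import Algebra.Properties.Semiring.Sum semiring using (sum; sum-cong-≋; sum-remove; ∑-distrib-+; ∑-comm; *-distribˡ-sum)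
  open import Relation.Binary.Reasoning.Setoid setoid

  ∑≡sum : ∀ {d} (f : Fin d → Carrier) → ∑ R f ≡ sum f
  ∑≡sum {zero}  f = ≡.refl
  ∑≡sum {suc d} f = ≡.cong (f zero ⊕_) (∑≡sum (f ∘ suc))

  ∑-cong : ∀ {d} {f g : Fin d → Carrier} → (∀ i → f i ≈ g i) → ∑ R f ≈ ∑ R g
  ∑-cong {f = f} {g} f≈g rewrite ∑≡sum f | ∑≡sum g = sum-cong-≋ f≈g

  ∑-zero : ∀ {d} {f : Fin d → Carrier} → (∀ i → f i ≈ 0#) → ∑ R f ≈ 0#
  ∑-zero {zero}  f≈0 = refl
  ∑-zero {suc d} f≈0 = trans (+-cong (f≈0 zero) (∑-zero (f≈0 ∘ suc))) (+-identityˡ 0#)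

  ∑-+ : ∀ {d} (f g : Fin d → Carrier) → ∑ R (λ i → f i ⊕ g i) ≈ ∑ R f ⊕ ∑ R g
  ∑-+ f g rewrite ∑≡sum (λ i → f i ⊕ g i) | ∑≡sum f | ∑≡sum g = ∑-distrib-+ f g

  ∑-*ˡ : ∀ {d} x (f : Fin d → Carrier) → x * ∑ R f ≈ ∑ R (λ i → x * f i)
  ∑-*ˡ x f rewrite ∑≡sum f | ∑≡sum (λ i → x * f i) = *-distribˡ-sum x f

  ∑-*ʳ : ∀ {d} x (f : Fin d → Carrier) → ∑ R f * x ≈ ∑ R (λ i → f i * x)
  ∑-*ʳ x f = trans (*-comm _ x) (trans (∑-*ˡ x f) (∑-cong λ i → *-comm x (f i)))

  ∑-swap : ∀ {d e} (f : Fin d → Fin e → Carrier) →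
           ∑ R (λ i → ∑ R (f i)) ≈ ∑ R (λ j → ∑ R (λ i → f i j))
  ∑-swap {d} {e} f = begin
    ∑ R (λ i → ∑ R (f i))           ≈⟨ ∑-cong (λ i → reflexive (∑≡sum (f i))) ⟩
    ∑ R (λ i → sum (f i))           ≡⟨ ∑≡sum (λ i → sum (f i)) ⟩
    sum (λ i → sum (f i))           ≈⟨ ∑-comm f ⟩
    sum (λ j → sum (λ i → f i j))   ≡⟨ ∑≡sum (λ j → sum (λ i → f i j)) ⟨
    ∑ R (λ j → sum (λ i → f i j))   ≈⟨ ∑-cong (λ j → reflexive (∑≡sum (λ i → f i j))) ⟨
    ∑ R (λ j → ∑ R (λ i → f i j))   ∎

  ∑-remove : ∀ {d} (f : Fin (suc d) → Carrier) j → ∑ R f ≈ f j ⊕ ∑ R (f ∘ punchIn j)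
  ∑-remove f j rewrite ∑≡sum f | ∑≡sum (f ∘ punchIn j) = sum-remove f

  -- Associativity of the product row, matrix, column; `comb-comb` and `dot-comb` are its two
  -- readings.
  ∑-assoc : ∀ {d e} (a : Fin d → Carrier) (b : Fin d → Fin e → Carrier) (c : Fin e → Carrier) →
            ∑ R (λ j → ∑ R (λ i → a i * b i j) * c j) ≈ ∑ R (λ i → a i * ∑ R (λ j → b i j * c j))
  ∑-assoc a b c = begin
    ∑ R (λ j → ∑ R (λ i → a i * b i j) * c j)   ≈⟨ ∑-cong (λ j → ∑-*ʳ (c j) (λ i → a i * b i j)) ⟩
    ∑ R (λ j → ∑ R (λ i → a i * b i j * c j))   ≈⟨ ∑-swap (λ j i → a i * b i j * c j) ⟩
    ∑ R (λ i → ∑ R (λ j → a i * b i j * c j))   ≈⟨ ∑-cong (λ i → ∑-cong (λ j → *-assoc (a i) (b i j) (c j))) ⟩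
    ∑ R (λ i → ∑ R (λ j → a i * (b i j * c j))) ≈⟨ ∑-cong (λ i → ∑-*ˡ (a i) (λ j → b i j * c j)) ⟨
    ∑ R (λ i → a i * ∑ R (λ j → b i j * c j))   ∎

-- Vectors, linear combinations and the standard bilinear form.

module Vectors (R : CommutativeRing 0ℓ 0ℓ) where
  open CommutativeRing R hiding (zero) renaming (_+_ to _⊕_)
  open Sums R public
  open import Relation.Binary.Reasoning.Setoid setoid

  Vector : ℕ → Set
  Vector n = Fin n → Carrier

  infix 4 _≋_
  _≋_ : ∀ {n} → Vector n → Vector n → Set
  x ≋ y = ∀ j → x j ≈ y j

  𝟎 : ∀ {n} → Vector n
  𝟎 j = 0#

  comb : ∀ {d n} → Vector d → (Fin d → Vector n) → Vector n
  comb a v j = ∑ R (λ i → a i * v i j)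

  dot : ∀ {n} → Vector n → Vector n → Carrier
  dot x y = ∑ R (λ j → x j * y j)

  Indep : ∀ {d n} → (Fin d → Vector n) → Set
  Indep v = ∀ a → comb a v ≋ 𝟎 → a ≋ 𝟎

  Span : ∀ {d n} → (Fin d → Vector n) → Vector n → Set
  Span {d} v x = Σ (Vector d) (λ a → x ≋ comb a v)

  dot-cong : ∀ {n} {x x' y y' : Vector n} → x ≋ x' → y ≋ y' → dot x y ≈ dot x' y'
  dot-cong x≋x' y≋y' = ∑-cong (λ j → *-cong (x≋x' j) (y≋y' j))

  dot-comm : ∀ {n} (x y : Vector n) → dot x y ≈ dot y x
  dot-comm x y = ∑-cong (λ j → *-comm (x j) (y j))

  dot-zeroˡ : ∀ {n} {x y : Vector n} → x ≋ 𝟎 → dot x y ≈ 0#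
  dot-zeroˡ {y = y} x≋0 = ∑-zero (λ j → trans (*-congʳ (x≋0 j)) (zeroˡ (y j)))

  dot-zeroʳ : ∀ {n} {x y : Vector n} → y ≋ 𝟎 → dot x y ≈ 0#
  dot-zeroʳ {x = x} {y} y≋0 = trans (dot-comm x y) (dot-zeroˡ y≋0)

  dot-axpy : ∀ {n} (x y : Vector n) s z → dot (λ j → x j ⊕ s * y j) z ≈ dot x z ⊕ s * dot y z
  dot-axpy x y s z = begin
    ∑ R (λ j → (x j ⊕ s * y j) * z j)         ≈⟨ ∑-cong (λ j → trans (distribʳ (z j) (x j) (s * y j)) (+-congˡ (*-assoc s (y j) (z j)))) ⟩
    ∑ R (λ j → x j * z j ⊕ s * (y j * z j))   ≈⟨ ∑-+ (λ j → x j * z j) (λ j → s * (y j * z j)) ⟩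
    dot x z ⊕ ∑ R (λ j → s * (y j * z j))     ≈⟨ +-congˡ (∑-*ˡ s (λ j → y j * z j)) ⟨
    dot x z ⊕ s * dot y z                     ∎

  dot-axpyʳ : ∀ {n} z (x y : Vector n) s → dot z (λ j → x j ⊕ s * y j) ≈ dot z x ⊕ s * dot z y
  dot-axpyʳ z x y s = trans (dot-comm z _) (trans (dot-axpy x y s z) (+-cong (dot-comm x z) (*-congˡ (dot-comm y z))))

  comb-congˡ : ∀ {d n} {a b : Vector d} (v : Fin d → Vector n) → a ≋ b → comb a v ≋ comb b v
  comb-congˡ v a≋b j = ∑-cong (λ i → *-congʳ (a≋b i))

  comb-congʳ : ∀ {d n} (a : Vector d) {v w : Fin d → Vector n} → (∀ i → v i ≋ w i) → comb a v ≋ comb a w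
  comb-congʳ a v≋w j = ∑-cong (λ i → *-congˡ (v≋w i j))

  comb-comb : ∀ {d e n} (a : Vector d) (b : Fin d → Vector e) (v : Fin e → Vector n) →
              comb (comb a b) v ≋ comb a (λ i → comb (b i) v)
  comb-comb a b v j = ∑-assoc a b (λ i → v i j)

  dot-comb : ∀ {d n} (a : Vector d) (v : Fin d → Vector n) y → dot (comb a v) y ≈ dot a (λ i → dot (v i) y)
  dot-comb a v y = ∑-assoc a v y

  dot-comb-⊥ : ∀ {d n} (a : Vector d) (v : Fin d → Vector n) y → (∀ i → dot (v i) y ≈ 0#) → dot (comb a v) y ≈ 0#
  dot-comb-⊥ a v y v⊥y = trans (dot-comb a v y) (dot-zeroʳ {x = a} v⊥y)

  δ : ∀ {n} → Fin n → Vector n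
  δ zero    zero    = 1#
  δ zero    (suc j) = 0#
  δ (suc i) zero    = 0#
  δ (suc i) (suc j) = δ i j

  dot-δ : ∀ {n} (x : Vector n) i → dot x (δ i) ≈ x i
  dot-δ x zero    = trans (+-cong (*-identityʳ (x zero)) (∑-zero (λ j → zeroʳ (x (suc j))))) (+-identityʳ (x zero))
  dot-δ x (suc i) = trans (+-cong (zeroʳ (x zero)) (dot-δ (x ∘ suc) i)) (+-identityˡ (x (suc i)))

  δ-sym : ∀ {n} (i j : Fin n) → δ i j ≡ δ j i
  δ-sym zero    zero    = ≡.refl
  δ-sym zero    (suc j) = ≡.refl
  δ-sym (suc i) zero    = ≡.refl
  δ-sym (suc i) (suc j) = δ-sym i j

  comb-δ : ∀ {n} (x : Vector n) → comb x δ ≋ x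
  comb-δ x j = trans (∑-cong (λ i → *-congˡ (reflexive (δ-sym i j)))) (dot-δ x j)

  δ-comb : ∀ {d n} i (v : Fin d → Vector n) → comb (δ i) v ≋ v i
  δ-comb i v j = trans (dot-comm (δ i) (λ l → v l j)) (dot-δ (λ l → v l j) i)

  comb-0∷ : ∀ {d n} (a : Vector d) (v : Fin (suc d) → Vector n) → comb (0# ∷ a) v ≋ comb a (v ∘ suc)
  comb-0∷ a v j = trans (+-congʳ (zeroˡ (v zero j))) (+-identityˡ _)

  indep-tail : ∀ {d n} (v : Fin (suc d) → Vector n) → Indep v → Indep (v ∘ suc)
  indep-tail v ind a av≋0 i = ind (0# ∷ a) (λ j → trans (comb-0∷ a v j) (av≋0 j)) (suc i)

  indep-↑ʳ : ∀ {n e} d (v : Fin (d + e) → Vector n) → Indep v → Indep (v ∘ (d ↑ʳ_))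
  indep-↑ʳ zero    v ind = ind
  indep-↑ʳ (suc d) v ind = indep-↑ʳ d (v ∘ suc) (indep-tail v ind)

  indep-∷ : ∀ {d n} x {v : Fin d → Vector n} → Indep v →
            (∀ a → comb a (x ∷ v) ≋ 𝟎 → a zero ≈ 0#) → Indep (x ∷ v)
  indep-∷ x {v} ind head≈0 a av≋0 zero    = head≈0 a av≋0
  indep-∷ x {v} ind head≈0 a av≋0 (suc i) = ind (a ∘ suc) tail≋0 i
    where
    tail≋0 : comb (a ∘ suc) v ≋ 𝟎
    tail≋0 j = begin
      comb (a ∘ suc) v j                 ≈⟨ +-identityˡ _ ⟨
      0# ⊕ comb (a ∘ suc) v j            ≈⟨ +-congʳ (trans (*-congʳ (head≈0 a av≋0)) (zeroˡ (x j))) ⟨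
      comb a (x ∷ v) j                   ≈⟨ av≋0 j ⟩
      0#                                 ∎

  span-∷ : ∀ {d n} x {v : Fin d → Vector n} {y} → Span v y → Span (x ∷ v) y
  span-∷ x {v} (a , y≋av) = 0# ∷ a , λ j → trans (y≋av j) (sym (comb-0∷ a (x ∷ v) j))

-- Elimination over a field with a decidable zero test.

module LinearAlgebra (R : CommutativeRing 0ℓ 0ℓ) (fld : IsField R)
                     (≈0? : ∀ x → Dec (CommutativeRing._≈_ R x (CommutativeRing.0# R))) where
  open CommutativeRing R hiding (zero) renaming (_+_ to _⊕_)
  open IsField fld using (0≉1; inverse)
  open Vectors R public
  open import Algebra.Properties.Ring ring using (-‿distribʳ-*; -‿distribˡ-*; +-cancelʳ)
  open import Relation.Binary.Reasoning.Setoid setoid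

  -- `d` is `-1/c`: adding `p * d` times a vector whose pairing is `c` cancels a pairing `p`.
  scale⁻¹ : ∀ c → ¬ (c ≈ 0#) → ∃ λ d → ∀ p → p ⊕ p * d * c ≈ 0#
  scale⁻¹ c c≉0 with inverse c c≉0
  ... | c⁻¹ , cc⁻¹≈1 = - c⁻¹ , λ p → begin
    p ⊕ p * - c⁻¹ * c         ≈⟨ +-congˡ (*-assoc p (- c⁻¹) c) ⟩
    p ⊕ p * (- c⁻¹ * c)       ≈⟨ +-congˡ (*-congˡ (-‿distribˡ-* c⁻¹ c)) ⟨
    p ⊕ p * - (c⁻¹ * c)       ≈⟨ +-congˡ (*-congˡ (-‿cong (trans (*-comm c⁻¹ c) cc⁻¹≈1))) ⟩
    p ⊕ p * - 1#              ≈⟨ +-congˡ (-‿distribʳ-* p 1#) ⟨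
    p ⊕ - (p * 1#)            ≈⟨ +-congˡ (-‿cong (*-identityʳ p)) ⟩
    p ⊕ - p                   ≈⟨ -‿inverseʳ p ⟩
    0#                        ∎

  *-cancel-0 : ∀ {x c} → ¬ (c ≈ 0#) → x * c ≈ 0# → x ≈ 0#
  *-cancel-0 {x} {c} c≉0 xc≈0 with scale⁻¹ c c≉0
  ... | d , inv = begin
    x                 ≈⟨ +-identityʳ x ⟨
    x ⊕ 0#            ≈⟨ +-congˡ (zeroʳ d) ⟨
    x ⊕ d * 0#        ≈⟨ +-congˡ (*-congˡ xc≈0) ⟨
    x ⊕ d * (x * c)   ≈⟨ +-congˡ (trans (*-congʳ (*-comm x d)) (*-assoc d x c)) ⟨
    x ⊕ x * d * c     ≈⟨ inv x ⟩
    0#                ∎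

  indep-𝟎 : ∀ {d n} {v : Fin d → Vector n} → Indep v → (∀ i → v i ≋ 𝟎) → d ≡ 0
  indep-𝟎 {zero}  ind v≋0 = ≡.refl
  indep-𝟎 {suc d} ind v≋0 = contradiction
    (sym (ind (λ _ → 1#) (λ j → dot-zeroʳ {x = λ _ → 1#} (λ i → v≋0 i j)) zero)) 0≉1

  -- `Q` is a basis of the orthogonal space of `v`, `double` is the double-annihilator inclusion,
  -- and `exact` is the dimension formula for independent `v`. They are proved jointly by induction
  -- on `v`, since `double` for the tail is what detects a dependent new vector.
  record Annihilator {p n} (v : Fin p → Vector n) (e : ℕ) : Set where
    field
      Q      : Fin e → Vector n
      ⊥Q     : ∀ i j → dot (v i) (Q j) ≈ 0#
      indep  : Indep Q
      spans  : ∀ y → (∀ i → dot (v i) y ≈ 0#) → Span Q y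
      double : ∀ y → (∀ j → dot y (Q j) ≈ 0#) → Span v y
      count  : n ≤ p + e
      exact  : Indep v → p + e ≡ n

  annihilator-[] : ∀ {n} (v : Fin 0 → Vector n) → Annihilator v n
  annihilator-[] {n} v = record
    { Q      = δ
    ; ⊥Q     = λ ()
    ; indep  = λ a aδ≋0 i → trans (sym (comb-δ a i)) (aδ≋0 i)
    ; spans  = λ y _ → y , λ j → sym (comb-δ y j)
    ; double = λ y y⊥ → (λ ()) , λ j → trans (sym (dot-δ y j)) (y⊥ j)
    ; count  = ℕ.≤-refl
    ; exact  = λ _ → ≡.refl
    }

  module _ {p n e} (v : Fin (suc p) → Vector n) (A : Annihilator (v ∘ suc) e) where
    open Annihilator A

    private x = v zero

    -- By `double` the new vector already lies in the span of the tail. So `Q` is kept, and `exact`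
    -- holds vacuously because `v` is dependent.
    annihilator-stay : (∀ j → dot x (Q j) ≈ 0#) → Annihilator v e
    annihilator-stay x⊥Q = record
      { Q      = Q
      ; ⊥Q     = λ { zero j → x⊥Q j ; (suc i) j → ⊥Q i j }
      ; indep  = indep
      ; spans  = λ y v⊥y → spans y (v⊥y ∘ suc)
      ; double = λ y y⊥ → let a , y≋ = double y y⊥ in 0# ∷ a , λ j → trans (y≋ j) (sym (comb-0∷ a v j))
      ; count  = ℕ.m≤n⇒m≤1+n count
      ; exact  = λ ind → contradiction (dependent ind) 0≉1
      }
      where
      dependent : Indep v → 0# ≈ 1#
      dependent ind with double x x⊥Q
      ... | a , x≋ = begin
        0#         ≈⟨ -‿inverseˡ 1# ⟨
        - 1# ⊕ 1#  ≈⟨ +-congʳ (ind (- 1# ∷ a) relation zero) ⟩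
        0# ⊕ 1#    ≈⟨ +-identityˡ 1# ⟩
        1#         ∎
        where
        relation : comb (- 1# ∷ a) v ≋ 𝟎
        relation j = begin
          - 1# * x j ⊕ comb a (v ∘ suc) j ≈⟨ +-cong (-‿distribˡ-* 1# (x j)) (x≋ j) ⟨
          - (1# * x j) ⊕ x j              ≈⟨ +-congʳ (-‿cong (*-identityˡ (x j))) ⟩
          - x j ⊕ x j                     ≈⟨ -‿inverseˡ (x j) ⟩
          0#                              ∎

  module _ {p n e} (v : Fin (suc p) → Vector n) (A : Annihilator (v ∘ suc) (suc e)) (j : Fin (suc e))
           (pivot : ¬ (dot (v zero) (Annihilator.Q A j) ≈ 0#)) where
    open Annihilator A

    private
      x = v zero
      c = dot x (Q j)
      d = proj₁ (scale⁻¹ c pivot)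
      d-inv = proj₂ (scale⁻¹ c pivot)

      -- Since d = −1/c, adding s i times Q j makes the remaining Q i orthogonal to x.
      s : Fin e → Carrier
      s i = dot x (Q (punchIn j i)) * d

      Q′ : Fin e → Vector n
      Q′ i a = Q (punchIn j i) a ⊕ s i * Q j a

      dot-Q′ : ∀ y i → dot y (Q′ i) ≈ dot y (Q (punchIn j i)) ⊕ s i * dot y (Q j)
      dot-Q′ y i = dot-axpyʳ y (Q (punchIn j i)) (Q j) (s i)

      lift : Vector e → Vector (suc e)
      lift b = insertAt b j (dot b s)

      -- Expanding the `Q′ i` collects the shifts into `dot b s` as the coefficient of `Q j`. `b⁺`
      -- is left general because independence builds it from `b` by `lift`, while spanning starts
      -- from a given `b⁺` and restricts it.
      comb-Q′ : ∀ b (b⁺ : Vector (suc e)) → dot b s ≈ b⁺ j → (∀ i → b i ≈ b⁺ (punchIn j i)) →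
                comb b Q′ ≋ comb b⁺ Q
      comb-Q′ b b⁺ b⁺j b⁺i a = begin
        ∑ R (λ i → b i * (Q (punchIn j i) a ⊕ s i * Q j a))                     ≈⟨ ∑-cong (λ i → trans (distribˡ (b i) _ _) (+-congˡ (sym (*-assoc (b i) (s i) (Q j a))))) ⟩
        ∑ R (λ i → b i * Q (punchIn j i) a ⊕ b i * s i * Q j a)                 ≈⟨ ∑-+ (λ i → b i * Q (punchIn j i) a) (λ i → b i * s i * Q j a) ⟩
        ∑ R (λ i → b i * Q (punchIn j i) a) ⊕ ∑ R (λ i → b i * s i * Q j a)     ≈⟨ +-comm _ _ ⟩
        ∑ R (λ i → b i * s i * Q j a) ⊕ ∑ R (λ i → b i * Q (punchIn j i) a)     ≈⟨ +-cong (sym (∑-*ʳ (Q j a) (λ i → b i * s i))) (∑-cong (λ i → *-congʳ (b⁺i i))) ⟩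
        dot b s * Q j a ⊕ ∑ R (λ i → b⁺ (punchIn j i) * Q (punchIn j i) a)      ≈⟨ +-congʳ (*-congʳ b⁺j) ⟩
        b⁺ j * Q j a ⊕ ∑ R (λ i → b⁺ (punchIn j i) * Q (punchIn j i) a)         ≈⟨ ∑-remove (λ i → b⁺ i * Q i a) j ⟨
        comb b⁺ Q a                                                             ∎

      ⊥Q′ : ∀ i l → dot (v i) (Q′ l) ≈ 0#
      ⊥Q′ zero    l = trans (dot-Q′ x l) (d-inv (dot x (Q (punchIn j l))))
      ⊥Q′ (suc i) l = begin
        dot (v (suc i)) (Q′ l)                                         ≈⟨ dot-Q′ (v (suc i)) l ⟩
        dot (v (suc i)) (Q (punchIn j l)) ⊕ s l * dot (v (suc i)) (Q j) ≈⟨ +-cong (⊥Q i (punchIn j l)) (*-congˡ (⊥Q i j)) ⟩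
        0# ⊕ s l * 0#                                                  ≈⟨ trans (+-identityˡ _) (zeroʳ (s l)) ⟩
        0#                                                             ∎

      indep′ : Indep Q′
      indep′ b bQ′≋0 i = begin
        b i                   ≡⟨ insertAt-punchIn b j (dot b s) i ⟨
        lift b (punchIn j i)  ≈⟨ indep (lift b) (λ a → trans (sym (comb-Q′ b (lift b) lift-j lift-i a)) (bQ′≋0 a)) (punchIn j i) ⟩
        0#                    ∎
        where
        lift-j = reflexive (≡.sym (insertAt-lookup b j (dot b s)))
        lift-i = λ l → reflexive (≡.sym (insertAt-punchIn b j (dot b s) l))

      spans′ : ∀ y → (∀ i → dot (v i) y ≈ 0#) → Span Q′ y
      spans′ y v⊥y with spans y (v⊥y ∘ suc)
      ... | b , y≋bQ = b ∘ punchIn j , λ a → trans (y≋bQ a) (sym (comb-Q′ (b ∘ punchIn j) b bs≈bj (λ _ → refl) a))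
        where
        S = ∑ R (λ i → b (punchIn j i) * dot x (Q (punchIn j i)))

        S⊕bjc≈0 : S ⊕ b j * c ≈ 0#
        S⊕bjc≈0 = begin
          S ⊕ b j * c                  ≈⟨ +-comm S (b j * c) ⟩
          b j * c ⊕ S                  ≈⟨ ∑-remove (λ i → b i * dot x (Q i)) j ⟨
          dot b (λ i → dot x (Q i))    ≈⟨ dot-cong {x = b} (λ _ → refl) (λ i → dot-comm x (Q i)) ⟩
          dot b (λ i → dot (Q i) x)    ≈⟨ dot-comb b Q x ⟨
          dot (comb b Q) x             ≈⟨ dot-cong y≋bQ (λ _ → refl) ⟨
          dot y x                      ≈⟨ dot-comm y x ⟩
          dot x y                      ≈⟨ v⊥y zero ⟩
          0#                           ∎

        -- Orthogonality of `y` to `x`, multiplied by `d = -1/c`, says that `b j` is exactly the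
        -- coefficient of `Q j` that the `Q′ i` force.
        bs≈bj : dot (b ∘ punchIn j) s ≈ b j
        bs≈bj = +-cancelʳ (b j * d * c) _ _ (begin
          dot (b ∘ punchIn j) s ⊕ b j * d * c  ≈⟨ +-cong (trans (∑-cong (λ i → sym (*-assoc (b (punchIn j i)) _ d))) (sym (∑-*ʳ d (λ i → b (punchIn j i) * dot x (Q (punchIn j i)))))) (trans (*-assoc (b j) d c) (trans (*-congˡ (*-comm d c)) (sym (*-assoc (b j) c d)))) ⟩
          S * d ⊕ b j * c * d                  ≈⟨ distribʳ d S (b j * c) ⟨
          (S ⊕ b j * c) * d                    ≈⟨ trans (*-congʳ S⊕bjc≈0) (zeroˡ d) ⟩
          0#                                   ≈⟨ d-inv (b j) ⟨
          b j ⊕ b j * d * c                    ∎)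

      double′ : ∀ y → (∀ l → dot y (Q′ l) ≈ 0#) → Span v y
      double′ y y⊥Q′ = - g ∷ proj₁ z∈ , λ a → begin
        y a                             ≈⟨ +-identityˡ (y a) ⟨
        0# ⊕ y a                        ≈⟨ +-congʳ (-‿inverseˡ (g * x a)) ⟨
        - (g * x a) ⊕ g * x a ⊕ y a     ≈⟨ +-assoc _ _ _ ⟩
        - (g * x a) ⊕ (g * x a ⊕ y a)   ≈⟨ +-cong (-‿distribˡ-* g (x a)) (+-comm (g * x a) (y a)) ⟩
        - g * x a ⊕ z a                 ≈⟨ +-congˡ (proj₂ z∈ a) ⟩
        comb (- g ∷ proj₁ z∈) v a       ∎
        where
        -- `g` makes `z = y + g x` orthogonal to `Q j`. Orthogonality to the other `Q l` is the
        -- hypothesis on `Q′` rearranged, so `double` for the tail applies to `z`.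
        g = dot y (Q j) * d

        z : Vector n
        z a = y a ⊕ g * x a

        z⊥Q : ∀ l → dot z (Q l) ≈ 0#
        z⊥Q l with j ≟ l
        ... | yes ≡.refl = trans (dot-axpy y x g (Q j)) (d-inv (dot y (Q j)))
        ... | no j≢l = ≡.subst (λ i → dot z (Q i) ≈ 0#) (punchIn-punchOut j≢l) (begin
          dot z (Q l′)                                ≈⟨ dot-axpy y x g (Q l′) ⟩
          dot y (Q l′) ⊕ dot y (Q j) * d * dot x (Q l′) ≈⟨ +-congˡ (trans (*-assoc (dot y (Q j)) d _) (trans (*-comm _ _) (*-congʳ (*-comm d _)))) ⟩
          dot y (Q l′) ⊕ dot x (Q l′) * d * dot y (Q j) ≈⟨ dot-Q′ y (punchOut j≢l) ⟨
          dot y (Q′ (punchOut j≢l))                   ≈⟨ y⊥Q′ (punchOut j≢l) ⟩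
          0#                                          ∎)
          where l′ = punchIn j (punchOut j≢l)

        z∈ : Span (v ∘ suc) z
        z∈ = double z z⊥Q

    annihilator-drop : Annihilator v e
    annihilator-drop = record
      { Q      = Q′
      ; ⊥Q     = ⊥Q′
      ; indep  = indep′
      ; spans  = spans′
      ; double = double′
      ; count  = ≡.subst (n ≤_) (ℕ.+-suc p e) count
      ; exact  = λ ind → ≡.trans (≡.sym (ℕ.+-suc p e)) (exact (indep-tail v ind))
      }

  annihilator : ∀ {p n} (v : Fin p → Vector n) → ∃ (Annihilator v)
  annihilator {zero}  {n} v = n , annihilator-[] v
  annihilator {suc p} v with annihilator (v ∘ suc)
  ... | e , A with any? (λ j → ¬? (≈0? (dot (v zero) (Annihilator.Q A j))))
  ... | no none = e , annihilator-stay v A λ j → decidable-stable (≈0? _) λ ≉0 → none (j , ≉0)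
  annihilator {suc p} v | suc e , A | yes (j , pivot) = e , annihilator-drop v A j pivot

  indep-≤ : ∀ {p n} {v : Fin p → Vector n} → Indep v → p ≤ n
  indep-≤ {p} {v = v} ind = ≡.subst (p ≤_) (Annihilator.exact A ind) (ℕ.m≤m+n p _)
    where A = proj₂ (annihilator v)

  -- A relation among the coordinate vectors of `v` in `w` is a relation among the `v i`, so these
  -- are `p` independent vectors of length `d`.
  steinitz : ∀ {p d n} {v : Fin p → Vector n} {w : Fin d → Vector n} →
             Indep v → (∀ i → Span w (v i)) → p ≤ d
  steinitz {v = v} {w} ind v∈w = indep-≤ {v = proj₁ ∘ v∈w} λ a ac≋0 → ind a λ j → begin
    comb a v j                                ≈⟨ comb-congʳ a (λ i → proj₂ (v∈w i)) j ⟩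
    comb a (λ i → comb (proj₁ (v∈w i)) w) j   ≈⟨ comb-comb a (proj₁ ∘ v∈w) w j ⟨
    comb (comb a (proj₁ ∘ v∈w)) w j           ≈⟨ dot-zeroˡ ac≋0 ⟩
    0#                                        ∎

-- Systems, their intersections with K-subspaces, and duality.

module Systems {q m : ℕ} (E : Ext q m) where
  open Ext E
  open Over E
  open import Relation.Binary.Reasoning.Setoid Kr.setoid
  private module SK = Sums K

  -- Decidability comes from finiteness: elements are compared by their indices in the enumeration.
  -- Basis coordinates carry the test over to `K`.
  F-≈0? : ∀ a → Dec (a F.≈ F.0#)
  F-≈0? a with enum-surj a | enum-surj F.0#
  ... | i , ei≈a | j , ej≈0 with i ≟ j
  ... | yes ≡.refl = yes (F.trans (F.sym ei≈a) ej≈0)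
  ... | no  i≢j    = no λ a≈0 → i≢j (enum-inj i j (F.trans ei≈a (F.trans a≈0 (F.sym ej≈0))))

  ι-0 : ι F.0# Kr.≈ Kr.0#
  ι-0 = +-cancelʳ (ι F.0#) _ _ (begin
    ι F.0# Kr.+ ι F.0#   ≈⟨ ι-+ F.0# F.0# ⟨
    ι (F.0# F.+ F.0#)    ≈⟨ ι-cong (F.+-identityˡ F.0#) ⟩
    ι F.0#               ≈⟨ Kr.+-identityˡ (ι F.0#) ⟨
    Kr.0# Kr.+ ι F.0#    ∎)
    where open import Algebra.Properties.Ring Kr.ring using (+-cancelʳ)

  ι-∑ : ∀ {d} (f : Fin d → F.Carrier) → ι (∑ Fq f) Kr.≈ ∑ K (ι ∘ f)
  ι-∑ {zero}  f = ι-0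
  ι-∑ {suc d} f = Kr.trans (ι-+ (f zero) _) (Kr.+-congˡ (ι-∑ (f ∘ suc)))

  ι-dot : ∀ {d} (f g : Fin d → F.Carrier) → ι (∑ Fq (λ i → f i F.* g i)) Kr.≈ ∑ K (λ i → ι (f i) Kr.* ι (g i))
  ι-dot f g = Kr.trans (ι-∑ (λ i → f i F.* g i)) (SK.∑-cong (λ i → ι-* (f i) (g i)))

  coord : Kr.Carrier → Fin m → F.Carrier
  coord x = proj₁ (basis-span x)

  coord-zero : ∀ {x} → (∀ l → coord x l F.≈ F.0#) → x Kr.≈ Kr.0#
  coord-zero {x} c≈0 = Kr.trans (proj₂ (basis-span x))
    (SK.∑-zero (λ l → Kr.trans (Kr.*-congʳ (Kr.trans (ι-cong (c≈0 l)) ι-0)) (Kr.zeroˡ (basis l))))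

  zero-coord : ∀ {x} → x Kr.≈ Kr.0# → ∀ l → coord x l F.≈ F.0#
  zero-coord {x} x≈0 = basis-indep (coord x) (Kr.trans (Kr.sym (proj₂ (basis-span x))) x≈0)

  K-≈0? : ∀ x → Dec (x Kr.≈ Kr.0#)
  K-≈0? x = map′ coord-zero zero-coord (all? (λ l → F-≈0? (coord x l)))

  module LF = LinearAlgebra Fq Fq-field F-≈0?
  module LK = LinearAlgebra K K-field K-≈0?

  ι-injective : ∀ {a} → ι a Kr.≈ Kr.0# → a F.≈ F.0#
  ι-injective {a} ιa≈0 = decidable-stable (F-≈0? a) λ a≉0 →
    let b , ab≈1 = IsField.inverse Fq-field a a≉0 in
    IsField.0≉1 K-field (begin
      Kr.0#            ≈⟨ Kr.zeroˡ (ι b) ⟨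
      Kr.0# Kr.* ι b   ≈⟨ Kr.*-congʳ ιa≈0 ⟨
      ι a Kr.* ι b     ≈⟨ ι-* a b ⟨
      ι (a F.* b)      ≈⟨ ι-cong ab≈1 ⟩
      ι F.1#           ≈⟨ ι-1 ⟩
      Kr.1#            ∎)

  ι-δ : ∀ {n} (i j : Fin n) → ι (LF.δ i j) Kr.≈ LK.δ i j
  ι-δ zero    zero    = ι-1
  ι-δ zero    (suc j) = ι-0
  ι-δ (suc i) zero    = ι-0
  ι-δ (suc i) (suc j) = ι-δ i j

  combF-zeroˡ : ∀ {d k} {a : Fin d → F.Carrier} (v : Fin d → V k) → a LF.≋ LF.𝟎 → combF a v ≋ 𝟘
  combF-zeroˡ v a≋0 j = LK.dot-zeroˡ (λ i → Kr.trans (ι-cong (a≋0 i)) ι-0)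

  combF-comb : ∀ {d e k} (a : Fin d → F.Carrier) (b : Fin d → Fin e → F.Carrier) (v : Fin e → V k) →
               combF (LF.comb a b) v ≋ combF a (λ i → combF (b i) v)
  combF-comb a b v j = Kr.trans (LK.comb-congˡ v (λ i → ι-dot a (λ p → b p i)) j)
                                (LK.comb-comb (ι ∘ a) (λ p → ι ∘ b p) v j)

  -- Puts an F_q-combination of elements of `K` into the form that `basis-indep` splits, so that one
  -- equation over `K` becomes `m` equations over F_q.
  coords-dot : ∀ {n} (a : Fin n → F.Carrier) (x : Fin n → Kr.Carrier) →
               ∑ K (λ i → ι (a i) Kr.* x i) Kr.≈
               ∑ K (λ l → ι (LF.dot a (λ i → coord (x i) l)) Kr.* basis l)
  coords-dot a x = begin
    ∑ K (λ i → ι (a i) Kr.* x i)                                              ≈⟨ SK.∑-cong (λ i → Kr.*-congˡ (proj₂ (basis-span (x i)))) ⟩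
    ∑ K (λ i → ι (a i) Kr.* ∑ K (λ l → ι (coord (x i) l) Kr.* basis l))       ≈⟨ SK.∑-assoc (ι ∘ a) (λ i l → ι (coord (x i) l)) basis ⟨
    ∑ K (λ l → ∑ K (λ i → ι (a i) Kr.* ι (coord (x i) l)) Kr.* basis l)       ≈⟨ SK.∑-cong (λ l → Kr.*-congʳ (ι-dot a (λ i → coord (x i) l))) ⟨
    ∑ K (λ l → ι (LF.dot a (λ i → coord (x i) l)) Kr.* basis l)               ∎

  -- Expanding the coefficients of a relation over `K` in the basis yields `m` relations over F_q
  -- among the same vectors.
  indep-ι : ∀ {d n} {a : Fin d → Fin n → F.Carrier} → LF.Indep a → LK.Indep (λ i → ι ∘ a i)
  indep-ι {a = a} ind μ μa≋0 i = coord-zero (λ l → ind (λ p → coord (μ p) l) (vanish l) i)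
    where
    vanish : ∀ l → LF.comb (λ p → coord (μ p) l) a LF.≋ LF.𝟎
    vanish l j = F.trans (LF.dot-comm (λ p → coord (μ p) l) (λ p → a p j))
      (basis-indep (λ l → LF.dot (λ p → a p j) (λ p → coord (μ p) l))
        (Kr.trans (Kr.sym (coords-dot (λ p → a p j) μ))
          (Kr.trans (LK.dot-comm (λ p → ι (a p j)) μ) (μa≋0 j))) l)

  -- A lower bound M for the dimension of U ∩ T with dim T = r, witnessed in the
  -- coordinates F_q^n of U rather than in U itself.
  Meets : ∀ {n k} → (Fin n → V k) → ℕ → ℕ → Set
  Meets {n} {k} u r M =
    Σ (Fin r → V k) λ B → IndepK B ×
    Σ (Fin M → Fin n → F.Carrier) λ a → LF.Indep a × ∀ i → SpanK B (combF (a i) u)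

  meets-bounded : ∀ {n k} {u : Fin n → V k} {r M} → Meets u r M → M ≤ n
  meets-bounded (_ , _ , _ , a-ind , _) = LF.indep-≤ a-ind

  meets-shrink : ∀ {n k} {u : Fin n → V k} {r} d {M} → Meets u r (d + M) → Meets u r M
  meets-shrink d (B , B-ind , a , a-ind , a∈) = B , B-ind , a ∘ (d ↑ʳ_) , LF.indep-↑ʳ d a a-ind , a∈ ∘ (d ↑ʳ_)

  hasDim⇒meets : ∀ {n k} {u : Fin n → V k} {r M} (B : Fin r → V k) → IndepK B →
                 HasDimF (Inter u B) M → Meets u r M
  hasDim⇒meets {u = u} B B-ind (b , b∈ , b-ind , _) = B , B-ind , a , a-ind , λ i →
    let c , b≋ = proj₂ (b∈ i) in c , λ j → Kr.trans (Kr.sym (b≋au i j)) (b≋ j)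
    where
    a = λ i → proj₁ (proj₁ (b∈ i))
    b≋au = λ i → proj₂ (proj₁ (b∈ i))
    a-ind : LF.Indep a
    a-ind x xa≋0 = b-ind x λ j → begin
      combF x b j                       ≈⟨ LK.comb-congʳ (ι ∘ x) b≋au j ⟩
      combF x (λ i → combF (a i) u) j   ≈⟨ combF-comb x a u j ⟨
      combF (LF.comb x a) u j           ≈⟨ combF-zeroˡ u xa≋0 j ⟩
      Kr.0#                             ∎

  -- U ∩ T is cut out in U by the K-linear equations of T, hence in F_q^n by their coordinates.
  meets⇒hasDim : ∀ {n k} {u : Fin n → V k} → IndepF u → ∀ {r M} → Meets u r M →
                 Σ ℕ λ M₀ → M ≤ M₀ × Σ (Fin r → V k) λ B → IndepK B × HasDimF (Inter u B) M₀
  meets⇒hasDim {n} {k} {u} u-ind {r} {M} (B , B-ind , a , a-ind , a∈) =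
    M₀ , LF.steinitz a-ind (λ i → Ann.spans (a i) (inB⇒eqns (a i) (a∈ i))) , B , B-ind ,
    (λ p → combF (Ann.Q p) u) ,
    (λ p → (Ann.Q p , λ _ → Kr.refl) , eqns⇒inB (Ann.Q p) (λ i → Ann.⊥Q i p)) ,
    (λ x xQu≋0 → Ann.indep x (u-ind _ λ j → Kr.trans (combF-comb x Ann.Q u j) (xQu≋0 j))) ,
    λ { x ((c , x≋cu) , x∈B) → let y , c≋yQ = Ann.spans c (inB⇒eqns c (spanK-cong x≋cu x∈B)) in
        y , λ j → Kr.trans (x≋cu j) (Kr.trans (LK.comb-congˡ u (λ i → ι-cong (c≋yQ i)) j) (combF-comb y Ann.Q u j)) }
    where
    module AnnB = LK.Annihilator (proj₂ (LK.annihilator B))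
    e = proj₁ (LK.annihilator B)

    spanK-cong : ∀ {x y} → x ≋ y → SpanK B x → SpanK B y
    spanK-cong x≋y (c , x≋) = c , λ j → Kr.trans (Kr.sym (x≋y j)) (x≋ j)

    value : Fin e → Fin n → Kr.Carrier
    value p i = LK.dot (u i) (AnnB.Q p)

    eqn : Fin (e · m) → Fin n → F.Carrier
    eqn pl i = let p , l = remQuot m pl in coord (value p i) l

    module Ann = LF.Annihilator (proj₂ (LF.annihilator eqn))
    M₀ = proj₁ (LF.annihilator eqn)

    value-dot : ∀ c p → LK.dot (combF c u) (AnnB.Q p) Kr.≈ ∑ K (λ l → ι (LF.dot c (λ i → coord (value p i) l)) Kr.* basis l)
    value-dot c p = Kr.trans (LK.dot-comb (ι ∘ c) u (AnnB.Q p)) (coords-dot c (value p))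

    inB⇒eqns : ∀ c → SpanK B (combF c u) → ∀ i → LF.dot (eqn i) c F.≈ F.0#
    inB⇒eqns c (b , cu≋bB) pl = let p , l = remQuot m pl in
      F.trans (LF.dot-comm (eqn pl) c) (basis-indep _
        (Kr.trans (Kr.sym (value-dot c p))
          (Kr.trans (LK.dot-cong cu≋bB (λ _ → Kr.refl)) (LK.dot-comb-⊥ b B (AnnB.Q p) (λ i → AnnB.⊥Q i p)))) l)

    eqns⇒inB : ∀ c → (∀ i → LF.dot (eqn i) c F.≈ F.0#) → SpanK B (combF c u)
    eqns⇒inB c c⊥ = AnnB.double (combF c u) λ p → Kr.trans (value-dot c p)
      (LK.dot-zeroˡ (λ l → Kr.trans (ι-cong (F.trans (LF.dot-comm c _) (entry p l))) ι-0))
      where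
      entry : ∀ p l → LF.dot (λ i → coord (value p i) l) c F.≈ F.0#
      entry p l = ≡.subst (λ (p , l) → LF.dot (λ i → coord (value p i) l) c F.≈ F.0#) (remQuot-combine p l) (c⊥ (combine p l))

  -- The rows of `G` are independent, so its columns span the whole space and one of them lies
  -- outside a proper subspace T. Adjoining it raises both dim T and the bound for U ∩ T by one and
  -- so keeps the defect.
  meets-extend : ∀ {n k} (G : Fin k → V n) → IndepK G → ∀ {r M} → r < k →
                 Meets (cols G) r M → Meets (cols G) (suc r) (suc M)
  meets-extend {n} {k} G G-ind {r} {M} r<k (B , B-ind , a , a-ind , a∈) with LK.annihilator B
  ... | e , A with any? (λ i → any? (λ p → ¬? (K-≈0? (LK.dot (cols G i) (LK.Annihilator.Q A p)))))
  ... | yes (i , p , pivot) =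
    cols G i ∷ B , LK.indep-∷ (cols G i) B-ind B-head ,
    LF.δ i ∷ a , LF.indep-∷ (LF.δ i) a-ind a-head ,
    λ { zero    → LK.δ zero , λ j → Kr.trans (δ-col j) (Kr.sym (LK.δ-comb zero (cols G i ∷ B) j))
      ; (suc l) → LK.span-∷ (cols G i) {v = B} (a∈ l) }
    where
    module A = LK.Annihilator A
    Qp = A.Q p

    δ-col : combF (LF.δ i) (cols G) ≋ cols G i
    δ-col j = Kr.trans (LK.comb-congˡ (cols G) (ι-δ i) j) (LK.δ-comb i (cols G) j)

    -- Q p separates column i from B, so a relation has no component along it.
    no-head : ∀ {d} (w : Fin (suc d) → V k) → w zero ≋ cols G i → (∀ l → LK.dot (w (suc l)) Qp Kr.≈ Kr.0#) →
              ∀ x → combK x w ≋ 𝟘 → x zero Kr.≈ Kr.0#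
    no-head w w₀≋ w⊥ x xw≋0 = LK.*-cancel-0 pivot (begin
      x zero Kr.* LK.dot (cols G i) Qp                      ≈⟨ Kr.*-congˡ (LK.dot-cong w₀≋ (λ _ → Kr.refl)) ⟨
      x zero Kr.* LK.dot (w zero) Qp                        ≈⟨ Kr.+-identityʳ _ ⟨
      x zero Kr.* LK.dot (w zero) Qp Kr.+ Kr.0#             ≈⟨ Kr.+-congˡ (LK.dot-zeroʳ {x = x ∘ suc} w⊥) ⟨
      LK.dot x (λ l → LK.dot (w l) Qp)                      ≈⟨ LK.dot-comb x w Qp ⟨
      LK.dot (combK x w) Qp                                 ≈⟨ LK.dot-zeroˡ xw≋0 ⟩
      Kr.0#                                                 ∎)

    B-head : ∀ x → combK x (cols G i ∷ B) ≋ 𝟘 → x zero Kr.≈ Kr.0#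
    B-head = no-head (cols G i ∷ B) (λ _ → Kr.refl) (λ l → A.⊥Q l p)

    a-head : ∀ x → LF.comb x (LF.δ i ∷ a) LF.≋ LF.𝟎 → x zero F.≈ F.0#
    a-head x xa≋0 = ι-injective (no-head (λ l → combF ((LF.δ i ∷ a) l) (cols G)) δ-col
      (λ l → let b , ≋bB = a∈ l in Kr.trans (LK.dot-cong ≋bB (λ _ → Kr.refl)) (LK.dot-comb-⊥ b B Qp (λ t → A.⊥Q t p)))
      (ι ∘ x) (λ j → Kr.trans (Kr.sym (combF-comb x (LF.δ i ∷ a) (cols G) j)) (combF-zeroˡ (cols G) xa≋0 j)))
  -- If every column satisfies the equations of `B`, each `Q p` is a relation among the rows of `G`,
  -- hence zero; then `B` has no equations at all and fills the space.
  ... | no none = contradiction r<k (ℕ.<-irrefl r≡k)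
    where
    module A = LK.Annihilator A

    Q≋0 : ∀ p → A.Q p ≋ 𝟘
    Q≋0 p = G-ind (A.Q p) λ i → Kr.trans (LK.dot-comm (A.Q p) (cols G i))
      (decidable-stable (K-≈0? _) λ ≉0 → none (i , p , ≉0))

    r≡k : r ≡ k
    r≡k = ≡.trans (≡.sym (ℕ.+-identityʳ r)) (≡.trans (≡.cong (r +_) (≡.sym (LK.indep-𝟎 A.indep Q≋0))) (A.exact B-ind))

  -- Combinations of a basis of A ⊆ F_q^n killed by H are codewords x G with x · G c = 0 for
  -- every c ∈ A^⊥; there are at least dim A − l independent ones if H A lies in an l-dimensional space.
  meets-dual : ∀ {n k k'} (G : Fin k → V n) (H : Fin k' → V n) →
               (∀ z → (∀ j → ⟪ z , H j ⟫ Kr.≈ Kr.0#) → SpanK G z) →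
               ∀ l d → Meets (cols H) l (l + d) →
               Σ ℕ λ e → d + e ≡ k × Meets (cols G) e (n ∸ (l + d))
  meets-dual {n} {k} G H H⊥⊆G l d (B , _ , a , a-ind , a∈) =
    e , X.exact x-ind , X.Q , X.indep ,
    ≡.subst (λ M → Σ (Fin M → Fin n → F.Carrier) λ c → LF.Indep c × ∀ i → SpanK X.Q (combF (c i) (cols G)))
      n∸ (A.Q , A.indep , λ j → X.spans _ (λ p → x⊥Gc p j))
    where
    -- The matrix expressing the vectors of H A in `B`; a vector in its kernel gives a K-combination
    -- of A that `H` kills.
    N : Fin l → V (l + d)
    N j i = proj₁ (a∈ i) j

    module N = LK.Annihilator (proj₂ (LK.annihilator N))
    e₀ = proj₁ (LK.annihilator N)

    d≤e₀ : d ≤ e₀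
    d≤e₀ = ℕ.+-cancelˡ-≤ l d e₀ N.count

    -- The kernel may be larger; exactly `d` independent vectors are kept so that the space
    -- orthogonal to `x` has dimension exactly `k - d`.
    kernel : Σ (Fin d → V (l + d)) λ w → LK.Indep w × ∀ j p → LK.dot (N j) (w p) Kr.≈ Kr.0#
    kernel with e₀ ∸ d | ℕ.m∸n+n≡m d≤e₀ | N.Q | N.indep | N.⊥Q
    ... | f | f+d≡e₀ | Q | Q-ind | ⊥Q rewrite ≡.sym f+d≡e₀ = Q ∘ (f ↑ʳ_) , LK.indep-↑ʳ f Q Q-ind , λ j p → ⊥Q j (f ↑ʳ p)

    w = proj₁ kernel

    ιa : Fin (l + d) → V n
    ιa i = ι ∘ a i

    z : Fin d → V n
    z p = combK (w p) ιa

    z⊥H : ∀ p j → ⟪ z p , H j ⟫ Kr.≈ Kr.0#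
    z⊥H p j = begin
      LK.dot (combK (w p) ιa) (H j)                            ≈⟨ LK.dot-comb (w p) ιa (H j) ⟩
      LK.dot (w p) (λ i → combF (a i) (cols H) j)              ≈⟨ LK.dot-cong {x = w p} (λ _ → Kr.refl) (λ i → proj₂ (a∈ i) j) ⟩
      combK (w p) (λ i → combK (proj₁ (a∈ i)) B) j             ≈⟨ LK.comb-comb (w p) (λ i → proj₁ (a∈ i)) B j ⟨
      combK (combK (w p) (λ i → proj₁ (a∈ i))) B j             ≈⟨ LK.dot-zeroˡ (λ t → Kr.trans (LK.dot-comm (w p) (N t)) (proj₂ (proj₂ kernel) t p)) ⟩
      Kr.0#                                                    ∎

    x : Fin d → V k
    x p = proj₁ (H⊥⊆G (z p) (z⊥H p))

    z≋xG : ∀ p → z p ≋ combK (x p) G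
    z≋xG p = proj₂ (H⊥⊆G (z p) (z⊥H p))

    x-ind : LK.Indep x
    x-ind c cx≋0 = proj₁ (proj₂ kernel) c (indep-ι a-ind (combK c w) λ j → begin
      combK (combK c w) ιa j                ≈⟨ LK.comb-comb c w ιa j ⟩
      combK c z j                           ≈⟨ LK.comb-congʳ c z≋xG j ⟩
      combK c (λ p → combK (x p) G) j       ≈⟨ LK.comb-comb c x G j ⟨
      combK (combK c x) G j                 ≈⟨ LK.dot-zeroˡ cx≋0 ⟩
      Kr.0#                                 ∎)

    module X = LK.Annihilator (proj₂ (LK.annihilator x))
    e = proj₁ (LK.annihilator x)

    module A = LF.Annihilator (proj₂ (LF.annihilator a))

    n∸ : proj₁ (LF.annihilator a) ≡ n ∸ (l + d)
    n∸ = ≡.trans (≡.sym (ℕ.m+n∸m≡n (l + d) _)) (≡.cong (_∸ (l + d)) (A.exact a-ind))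

    x⊥Gc : ∀ p j → LK.dot (x p) (combF (A.Q j) (cols G)) Kr.≈ Kr.0#
    x⊥Gc p j = begin
      LK.dot (x p) (λ i → LK.dot (ι ∘ A.Q j) (G i))  ≈⟨ LK.dot-cong {x = x p} (λ _ → Kr.refl) (λ i → LK.dot-comm (ι ∘ A.Q j) (G i)) ⟩
      LK.dot (x p) (λ i → LK.dot (G i) (ι ∘ A.Q j))  ≈⟨ LK.dot-comb (x p) G (ι ∘ A.Q j) ⟨
      LK.dot (combK (x p) G) (ι ∘ A.Q j)             ≈⟨ LK.dot-cong (z≋xG p) (λ _ → Kr.refl) ⟨
      LK.dot (combK (w p) ιa) (ι ∘ A.Q j)            ≈⟨ LK.dot-comb-⊥ (w p) ιa (ι ∘ A.Q j) (λ i → Kr.trans (Kr.sym (ι-dot (a i) (A.Q j))) (Kr.trans (ι-cong (A.⊥Q i j)) ι-0)) ⟩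
      Kr.0#                                          ∎

  module _ {n k k'} {G : Fin k → V n} {H : Fin k' → V n} (G-ind : IndepK G) (dual : GenOfDual G H) where
    private
      module A = LK.Annihilator (proj₂ (LK.annihilator G))

      ⊥G⇒InDual : ∀ {z} → (∀ i → LK.dot (G i) z Kr.≈ Kr.0#) → InDual G z
      ⊥G⇒InDual {z} z⊥ c (b , c≋bG) = begin
        LK.dot z c            ≈⟨ LK.dot-comm z c ⟩
        LK.dot c z            ≈⟨ LK.dot-cong c≋bG (λ _ → Kr.refl) ⟩
        LK.dot (combK b G) z  ≈⟨ LK.dot-comb-⊥ b G z z⊥ ⟩
        Kr.0#                 ∎

      span-self : ∀ {d} (v : Fin d → V n) i → SpanK v (v i)
      span-self v i = LK.δ i , λ j → Kr.sym (LK.δ-comb i v j)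

    G⊥⊆H : ∀ z → (∀ i → ⟪ z , G i ⟫ Kr.≈ Kr.0#) → SpanK H z
    G⊥⊆H z z⊥ = proj₂ (proj₂ dual z) (⊥G⇒InDual λ i → Kr.trans (LK.dot-comm (G i) z) (z⊥ i))

    private
      Q∈H : ∀ j → SpanK H (A.Q j)
      Q∈H j = proj₂ (proj₂ dual (A.Q j)) (⊥G⇒InDual λ i → A.⊥Q i j)

    -- The orthogonal space of `G` lies in the span of `H`, so `z` is orthogonal to it and `double`
    -- returns `z` to the code.
    H⊥⊆G : ∀ z → (∀ i → ⟪ z , H i ⟫ Kr.≈ Kr.0#) → SpanK G z
    H⊥⊆G z z⊥ = A.double z λ j → let b , Q≋bH = Q∈H j in begin
      LK.dot z (A.Q j)      ≈⟨ LK.dot-comm z (A.Q j) ⟩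
      LK.dot (A.Q j) z      ≈⟨ LK.dot-cong Q≋bH (λ _ → Kr.refl) ⟩
      LK.dot (combK b H) z  ≈⟨ LK.dot-comb-⊥ b H z (λ i → Kr.trans (LK.dot-comm (H i) z) (z⊥ i)) ⟩
      Kr.0#                 ∎

    -- `H` and the annihilator basis of `G` are independent and span each other, so exchange in both
    -- directions equates their sizes.
    dual-dimension : k + k' ≡ n
    dual-dimension = ≡.trans (≡.cong (k +_) (ℕ.≤-antisym
      (LK.steinitz (proj₁ dual) λ i → A.spans (H i) λ j →
        Kr.trans (LK.dot-comm (G j) (H i)) (proj₁ (proj₂ dual (H i)) (span-self H i) (G j) (span-self G j)))
      (LK.steinitz A.indep Q∈H))) (A.exact G-ind)

-- Searches on natural numbers and the arithmetic of the intervals.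

-- A witness that is not maximal is followed by a larger one, and the bound `n` stops this; the fuel
-- keeps `n < M' + f`. The double negation stays because `P` is not decided.
¬¬-maximum : ∀ {P : ℕ → Set} n → (∀ {M} → P M → M ≤ n) → ∀ {M} → P M →
             ¬ ¬ (Σ ℕ λ M* → M ≤ M* × P M* × ∀ {M'} → P M' → M' ≤ M*)
¬¬-maximum {P} n P≤n {M} PM none = search (suc n) PM ℕ.≤-refl (ℕ.m≤n+m (suc n) _)
  where
  search : ∀ f {M'} → P M' → M ≤ M' → ¬ (n < M' + f)
  search zero    {M'} PM' _    n<M' = ℕ.<⇒≱ n<M' (≡.subst (_≤ n) (≡.sym (ℕ.+-identityʳ M')) (P≤n PM'))
  search (suc f) {M'} PM' M≤M' n<   = none (M' , M≤M' , PM' , λ {M″} PM″ → ℕ.≮⇒≥ λ M'<M″ →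
    search f PM″ (ℕ.≤-trans M≤M' (ℕ.<⇒≤ M'<M″))
      (ℕ.≤-trans n< (ℕ.≤-trans (ℕ.≤-reflexive (ℕ.+-suc M' f)) (ℕ.+-monoˡ-≤ f M'<M″))))

-- A discrete intermediate value property, used to locate the block of a number with respect to `t`,
-- `ε` and their sum.
crossing : ∀ (f : ℕ → ℕ) {y} s → f 0 ≤ y → y < f s → Σ ℕ λ i → i < s × f i ≤ y × y < f (suc i)
crossing f zero    f0≤y y<f0 = contradiction y<f0 (ℕ.≤⇒≯ f0≤y)
crossing f {y} (suc s) f0≤y y<fs with f s ≤? y
... | yes fs≤y = s , ℕ.≤-refl , fs≤y , y<fs
... | no  fs≰y = let i , i<s , p = crossing f s f0≤y (ℕ.≰⇒> fs≰y) in i , ℕ.m≤n⇒m≤1+n i<s , p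

stepwise-mono : ∀ (f : ℕ → ℕ) {s} → (∀ i → i < s → f i ≤ f (suc i)) → ∀ {i j} → i ≤ j → j ≤ s → f i ≤ f j
stepwise-mono f step i≤j = go (ℕ.≤⇒≤′ i≤j)
  where
  go : ∀ {i j} → i ≤′ j → j ≤ _ → f i ≤ f j
  go ≤′-refl          _   = ℕ.≤-refl
  go (≤′-step i≤′j) j<s = ℕ.≤-trans (go i≤′j (ℕ.<⇒≤ j<s)) (step _ j<s)

1+n∸[n∸m] : ∀ {m n} → m ≤ n → suc n ∸ (n ∸ m) ≡ suc m
1+n∸[n∸m] {m} {n} m≤n = ≡.trans (ℕ.+-∸-assoc 1 (ℕ.m∸n≤m n m)) (≡.cong suc (ℕ.m∸[m∸n]≡n m≤n))

module Intervals (n k s : ℕ) (t ε : ℕ → ℕ) (t0 : t 0 ≡ 0) (ε0 : ε 0 ≡ 0) (ts : t s ≡ k) (εs : ε s ≡ n ∸ k)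
                 (k≤n : k ≤ n) (t-step : ∀ i → i < s → t i ≤ t (suc i)) (ε-step : ∀ i → i < s → ε i ≤ ε (suc i)) where

  -- The index of `InJ` is shifted to start at 0: its `j` stands for the interval J with index
  -- `j + 1`.
  InI InJ : ℕ → Set
  InI x = Σ ℕ λ i → i < s × 1 + ε i + t i ≤ x × x ≤ t (suc i) + ε i
  InJ x = Σ ℕ λ j → j < s × 1 + ε j + t (suc j) ≤ x × x ≤ ε (suc j) + t (suc j)

  t-mono : ∀ {i j} → i ≤ j → j ≤ s → t i ≤ t j
  t-mono = stepwise-mono t t-step

  ε-mono : ∀ {i j} → i ≤ j → j ≤ s → ε i ≤ ε j
  ε-mono = stepwise-mono ε ε-step

  k+ε≤n : ∀ {y i} → y ≤ k → i ≤ s → y + ε i ≤ n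
  k+ε≤n {y} {i} y≤k i≤s = begin
    y + ε i      ≤⟨ ℕ.+-mono-≤ y≤k (ε-mono i≤s ℕ.≤-refl) ⟩
    k + ε s      ≡⟨ ≡.cong (k +_) εs ⟩
    k + (n ∸ k)  ≡⟨ ℕ.m+[n∸m]≡n k≤n ⟩
    n            ∎
    where open ℕ.≤-Reasoning

  -- The points `ε i + t i` cut {1,...,n} into blocks, and `t (suc i) + ε i` splits each block into
  -- its I-part below and its J-part above.
  InJ⇔∁InI : ∀ x → InJ x ⇔ (1 ≤ x × x ≤ n × ¬ InI x)
  InJ⇔∁InI x = mk⇔ to from
    where
    open ℕ.≤-Reasoning
    to : InJ x → 1 ≤ x × x ≤ n × ¬ InI x
    to (j , j<s , lo , hi) = ℕ.≤-trans (s≤s z≤n) lo ,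
      ℕ.≤-trans hi (ℕ.≤-trans (ℕ.≤-reflexive (ℕ.+-comm (ε (suc j)) _)) (k+ε≤n (ℕ.≤-trans (t-mono j<s ℕ.≤-refl) (ℕ.≤-reflexive ts)) j<s)) ,
      disjoint
      where
      disjoint : ¬ InI x
      disjoint (i , i<s , lo′ , hi′) with i ≤? j
      ... | yes i≤j = ℕ.<-irrefl ≡.refl (begin-strict
        x                    ≤⟨ hi′ ⟩
        t (suc i) + ε i      ≤⟨ ℕ.+-mono-≤ (t-mono (s≤s i≤j) j<s) (ε-mono i≤j (ℕ.<⇒≤ j<s)) ⟩
        t (suc j) + ε j      ≡⟨ ℕ.+-comm (t (suc j)) (ε j) ⟩
        ε j + t (suc j)      <⟨ lo ⟩
        x                    ∎)
      ... | no i≰j = ℕ.<-irrefl ≡.refl (begin-strict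
        x                       ≤⟨ hi ⟩
        ε (suc j) + t (suc j)   ≤⟨ ℕ.+-mono-≤ (ε-mono (ℕ.≰⇒> i≰j) (ℕ.<⇒≤ i<s)) (t-mono (ℕ.≰⇒> i≰j) (ℕ.<⇒≤ i<s)) ⟩
        ε i + t i               <⟨ lo′ ⟩
        x                       ∎)

    from : 1 ≤ x × x ≤ n × ¬ InI x → InJ x
    from (s≤s {n = y} _ , y<n , x∉I)
      -- Blocks exclude their left end and include their right one, so the crossing is sought for
      -- `y = x - 1`.
      with crossing (λ i → ε i + t i) {y} s (ℕ.≤-trans (ℕ.≤-reflexive (≡.cong₂ _+_ ε0 t0)) z≤n)
             (ℕ.≤-trans y<n (ℕ.≤-reflexive (≡.sym (≡.trans (≡.cong₂ _+_ εs ts) (ℕ.m∸n+n≡m k≤n)))))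
    ... | i , i<s , lo , hi with suc y ≤? t (suc i) + ε i
    ... | yes y<  = contradiction (i , i<s , s≤s lo , y<) x∉I
    ... | no  y≮ = i , i<s , ℕ.≤-trans (ℕ.≤-reflexive (≡.cong suc (ℕ.+-comm (ε i) _))) (ℕ.≰⇒> y≮) , hi

  module _ (W : ℕ → ℕ → Set) (W-unique : ∀ r {d d'} → W r d → W r d' → d ≡ d') where

    -- With `y = k - r` in block `i`, the number `n + 1 - d` is `y + ε i + 1`; the converse recovers
    -- `y` from `x` by this formula. `W-unique` identifies an arbitrary weight in the set with the
    -- computed one.
    weights⇔InI : (∀ r → 1 ≤ r → r ≤ k → ∀ i → i < s → t i ≤ k ∸ r → k ∸ r < t (suc i) → W r (n ∸ (k ∸ r) ∸ ε i)) →
                  ∀ x → (Σ ℕ λ r → Σ ℕ λ d → 1 ≤ r × r ≤ k × W r d × x ≡ suc n ∸ d) ⇔ InI x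
    weights⇔InI weight x = mk⇔ to from
      where
      open ℕ.≤-Reasoning

      value : ∀ {y i} → y ≤ k → i < s → suc n ∸ (n ∸ y ∸ ε i) ≡ suc (y + ε i)
      value {y} {i} y≤k i<s = ≡.trans (≡.cong (suc n ∸_) (ℕ.∸-+-assoc n y (ε i))) (1+n∸[n∸m] (k+ε≤n y≤k (ℕ.<⇒≤ i<s)))

      to : (Σ ℕ λ r → Σ ℕ λ d → 1 ≤ r × r ≤ k × W r d × x ≡ suc n ∸ d) → InI x
      to (r , d , 1≤r , r≤k , w , x≡)
        with crossing t {k ∸ r} s (ℕ.≤-trans (ℕ.≤-reflexive t0) z≤n)
               (ℕ.≤-trans (ℕ.∸-monoʳ-< 1≤r r≤k) (ℕ.≤-reflexive (≡.sym ts)))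
      ... | i , i<s , lo , hi = i , i<s ,
        (begin
          suc (ε i + t i)      ≡⟨ ≡.cong suc (ℕ.+-comm (ε i) (t i)) ⟩
          suc (t i + ε i)      ≤⟨ s≤s (ℕ.+-monoˡ-≤ (ε i) lo) ⟩
          suc (k ∸ r + ε i)    ≡⟨ x≡′ ⟨
          x                    ∎) ,
        (begin
          x                    ≡⟨ x≡′ ⟩
          suc (k ∸ r) + ε i    ≤⟨ ℕ.+-monoˡ-≤ (ε i) hi ⟩
          t (suc i) + ε i      ∎)
        where
        x≡′ : x ≡ suc (k ∸ r + ε i)
        x≡′ = ≡.trans x≡ (≡.trans (≡.cong (suc n ∸_) (W-unique r w (weight r 1≤r r≤k i i<s lo hi))) (value (ℕ.m∸n≤m k r) i<s))

      from : InI x → Σ ℕ λ r → Σ ℕ λ d → 1 ≤ r × r ≤ k × W r d × x ≡ suc n ∸ d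
      from (i , i<s , lo , hi) = k ∸ y , _ , ℕ.m<n⇒0<n∸m y<k , ℕ.m∸n≤m k y ,
        weight (k ∸ y) (ℕ.m<n⇒0<n∸m y<k) (ℕ.m∸n≤m k y) i i<s
          (≡.subst (t i ≤_) (≡.sym k∸[k∸y]) t≤y) (≡.subst (_< t (suc i)) (≡.sym k∸[k∸y]) y<t) ,
        ≡.trans (≡.sym x≡) (≡.trans (≡.sym (value (ℕ.<⇒≤ y<k) i<s)) (≡.cong (λ z → suc n ∸ (n ∸ z ∸ ε i)) (≡.sym k∸[k∸y])))
        where
        y = x ∸ suc (ε i)

        x≡ : suc (y + ε i) ≡ x
        x≡ = ≡.trans (≡.sym (ℕ.+-suc y (ε i))) (ℕ.m∸n+n≡m (ℕ.≤-trans (ℕ.m≤m+n (suc (ε i)) (t i)) lo))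

        t≤y : t i ≤ y
        t≤y = ℕ.≤-trans (ℕ.≤-reflexive (≡.sym (ℕ.m+n∸m≡n (suc (ε i)) (t i)))) (ℕ.∸-monoˡ-≤ (suc (ε i)) lo)

        y<t : y < t (suc i)
        y<t = ℕ.+-cancelʳ-≤ (ε i) (suc y) (t (suc i)) (ℕ.≤-trans (ℕ.≤-reflexive x≡) hi)

        y<k : y < k
        y<k = ℕ.≤-trans y<t (ℕ.≤-trans (t-mono i<s ℕ.≤-refl) (ℕ.≤-reflexive ts))

        k∸[k∸y] : k ∸ (k ∸ y) ≡ y
        k∸[k∸y] = ℕ.m∸[m∸n]≡n (ℕ.<⇒≤ y<k)

    weights⇔InJ : (∀ r → 1 ≤ r → r ≤ n ∸ k → ∀ j → j < s → ε j < r → r ≤ ε (suc j) → W r (r + t (suc j))) →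
                  ∀ x → (Σ ℕ λ r → Σ ℕ λ d → 1 ≤ r × r ≤ n ∸ k × W r d × x ≡ d) ⇔ InJ x
    weights⇔InJ weight x = mk⇔ to from
      where
      to : (Σ ℕ λ r → Σ ℕ λ d → 1 ≤ r × r ≤ n ∸ k × W r d × x ≡ d) → InJ x
      to (suc r , d , 1≤r , r≤ , w , ≡.refl)
        with crossing ε {r} s (ℕ.≤-trans (ℕ.≤-reflexive ε0) z≤n) (ℕ.≤-trans r≤ (ℕ.≤-reflexive (≡.sym εs)))
      ... | j , j<s , lo , hi rewrite W-unique (suc r) w (weight (suc r) 1≤r r≤ j j<s (s≤s lo) hi) =
        j , j<s , s≤s (ℕ.+-monoˡ-≤ (t (suc j)) lo) , ℕ.+-monoˡ-≤ (t (suc j)) hi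

      from : InJ x → Σ ℕ λ r → Σ ℕ λ d → 1 ≤ r × r ≤ n ∸ k × W r d × x ≡ d
      from (j , j<s , lo , hi) = r , r + t (suc j) , ℕ.≤-trans (s≤s z≤n) ε<r , r≤ , weight r (ℕ.≤-trans (s≤s z≤n) ε<r) r≤ j j<s ε<r r≤ε , ≡.sym x≡
        where
        r = x ∸ t (suc j)

        x≡ : r + t (suc j) ≡ x
        x≡ = ℕ.m∸n+n≡m (ℕ.≤-trans (ℕ.m≤n+m (t (suc j)) (suc (ε j))) lo)

        ε<r : ε j < r
        ε<r = ℕ.+-cancelʳ-≤ (t (suc j)) (suc (ε j)) r (ℕ.≤-trans lo (ℕ.≤-reflexive (≡.sym x≡)))

        r≤ε : r ≤ ε (suc j)
        r≤ε = ℕ.+-cancelʳ-≤ (t (suc j)) r (ε (suc j)) (ℕ.≤-trans (ℕ.≤-reflexive x≡) hi)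

        r≤ : r ≤ n ∸ k
        r≤ = ℕ.≤-trans r≤ε (ℕ.≤-trans (ε-mono j<s ℕ.≤-refl) (ℕ.≤-reflexive εs))

-- Maximum defects and generalized rank weights.

module Weights {q m : ℕ} (E : Ext q m) where
  open Ext E
  open Over E
  open Systems E

  genRankWeight-unique : ∀ {n k} {u : Fin n → V k} r {d d'} → GenRankWeight u r d → GenRankWeight u r d' → d ≡ d'
  genRankWeight-unique {n} r (M , ≡.refl , (B , B-ind , dim) , max) (M' , ≡.refl , (B' , B'-ind , dim') , max') =
    ≡.cong (n ∸_) (ℕ.≤-antisym (max' B B-ind M dim) (max B' B'-ind M' dim'))

  module _ {n k} {u : Fin n → V k} (u-ind : IndepF u) where

    -- The witness has some exact dimension `M₀` at least `M`, and maximality forces equality. The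
    -- conclusion has the shape shared by `MaxDefect` and `GenRankWeight`.
    attain : ∀ {r M} → Meets u r M → (∀ {M'} → Meets u r M' → M' ≤ M) →
             (Σ (Fin r → V k) λ B → IndepK B × HasDimF (Inter u B) M)
             × (∀ (B : Fin r → V k) → IndepK B → ∀ M' → HasDimF (Inter u B) M' → M' ≤ M)
    attain {r} {M} meets max = exact (meets⇒hasDim u-ind meets) , λ B B-ind M' dim → max (hasDim⇒meets B B-ind dim)
      where
      exact : (Σ ℕ λ M₀ → M ≤ M₀ × Σ (Fin r → V k) λ B → IndepK B × HasDimF (Inter u B) M₀) →
              Σ (Fin r → V k) λ B → IndepK B × HasDimF (Inter u B) M
      exact (M₀ , M≤M₀ , B , B-ind , dim) = B , B-ind ,
        ≡.subst (HasDimF (Inter u B)) (ℕ.≤-antisym (max (hasDim⇒meets B B-ind dim)) M≤M₀) dim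

    genRankWeight : ∀ r {M} → Meets u (k ∸ r) M → (∀ {M'} → Meets u (k ∸ r) M' → M' ≤ M) → GenRankWeight u r (n ∸ M)
    genRankWeight r meets max = _ , ≡.refl , attain meets max

    maxDefect⇒≤ : ∀ {r e} → MaxDefect u r e → ∀ {M} → Meets u r M → M ≤ r + e
    maxDefect⇒≤ (_ , max) meets = let M₀ , M≤M₀ , B , B-ind , dim = meets⇒hasDim u-ind meets in
      ℕ.≤-trans M≤M₀ (max B B-ind M₀ dim)

  meets-extend* : ∀ {n k} (G : Fin k → V n) → IndepK G → ∀ d {r M} → d + r ≤ k →
                  Meets (cols G) r M → Meets (cols G) (d + r) (d + M)
  meets-extend* G G-ind zero    _     meets = meets
  meets-extend* G G-ind (suc d) d+r<k meets = meets-extend G G-ind d+r<k (meets-extend* G G-ind d (ℕ.<⇒≤ d+r<k) meets)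

  meets-grow : ∀ {n k} (G : Fin k → V n) → IndepK G → ∀ {r r' e} → r ≤ r' → r' ≤ k →
               Meets (cols G) r (r + e) → Meets (cols G) r' (r' + e)
  meets-grow G G-ind {r} {r'} {e} r≤r' r'≤k meets =
    ≡.subst₂ (Meets (cols G)) (ℕ.m∸n+n≡m r≤r')
      (≡.trans (≡.sym (ℕ.+-assoc (r' ∸ r) r e)) (≡.cong (_+ e) (ℕ.m∸n+n≡m r≤r')))
      (meets-extend* G G-ind (r' ∸ r) (≡.subst (_≤ _) (≡.sym (ℕ.m∸n+n≡m r≤r')) r'≤k) meets)

  module Defects {n k : ℕ} (G : Fin k → V n) (G-ind : IndepK G) (u-ind : IndepF (cols G))
                 (s : ℕ) (t ε : ℕ → ℕ) (t0 : t 0 ≡ 0) (ε0 : ε 0 ≡ 0)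
                 (ε-inc : ∀ i → i < s → ε i < ε (suc i))
                 (defect : ∀ i → 1 ≤ i → i ≤ s → t i ≤ k × MaxDefect (cols G) (t i) (ε i)
                           × (∀ r → r < t i → ¬ MaxDefect (cols G) r (ε i)))
                 (complete : ∀ r e → r ≤ k → MaxDefect (cols G) r e → 0 < e →
                             Σ ℕ (λ i → 1 ≤ i × i ≤ s × e ≡ ε i)) where

    private
      u = cols G

      t≤k : ∀ j → j < s → t (suc j) ≤ k
      t≤k j j<s = proj₁ (defect (suc j) (s≤s z≤n) j<s)

      ε≤ : ∀ j → j < s → ∀ {e} → Meets u (t (suc j)) (t (suc j) + e) → e ≤ ε (suc j)
      ε≤ j j<s meets = ℕ.+-cancelˡ-≤ (t (suc j)) _ _
        (maxDefect⇒≤ u-ind (proj₁ (proj₂ (defect (suc j) (s≤s z≤n) j<s))) meets)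

    attained : ∀ i → i ≤ s → Meets u (t i) (t i + ε i)
    -- The zero subspace attains the defect 0 at `t 0`, which `defect` does not cover.
    attained zero    _   rewrite t0 | ε0 = (λ ()) , (λ _ _ ()) , (λ ()) , (λ _ _ ()) , λ ()
    attained (suc i) i<s = let (B , B-ind , dim) , _ = proj₁ (proj₂ (defect (suc i) (s≤s z≤n) i<s)) in
      hasDim⇒meets B B-ind dim

    -- Were a larger defect attained in a smaller dimension, growing its subspace to dimension
    -- `t (suc i)` would exceed the maximum there.
    t-step : ∀ i → i < s → t i ≤ t (suc i)
    t-step zero    _   = ℕ.≤-trans (ℕ.≤-reflexive t0) z≤n
    t-step (suc i) i<s = ℕ.≮⇒≥ λ t> → ℕ.<⇒≱ (ε-inc (suc i) i<s)
      (ε≤ i (ℕ.<⇒≤ i<s) (meets-grow G G-ind (ℕ.<⇒≤ t>) (t≤k i (ℕ.<⇒≤ i<s)) (attained (suc (suc i)) i<s)))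

    ε-step : ∀ i → i < s → ε i ≤ ε (suc i)
    ε-step i i<s = ℕ.<⇒≤ (ε-inc i i<s)

    -- Otherwise the maximal defect in dimension e would be some ε i with i > j. Growing the
    -- subspace to dimension t (suc j) forces i = suc j, against the minimality of t (suc j).
    meets-bound : ∀ j → j < s → ∀ {e M} → e < t (suc j) → Meets u e M → M ≤ e + ε j
    meets-bound j j<s {e} e<t meets = ℕ.≮⇒≥ λ big → ¬¬-maximum n meets-bounded meets λ
      (M* , M≤M* , meets* , max) → absurd (ℕ.≤-trans big M≤M*) meets* max
        (ℕ.m≤n⇒∃[o]m+o≡n (ℕ.≤-trans (ℕ.m≤m+n e (ε j)) (ℕ.≤-trans (ℕ.<⇒≤ big) M≤M*)))
      where
      absurd : ∀ {M*} → e + ε j < M* → Meets u e M* → (∀ {M'} → Meets u e M' → M' ≤ M*) → ¬ (∃ λ d → e + d ≡ M*)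
      absurd big meets* max (d , ≡.refl) =
        no-value (complete e d (ℕ.≤-trans (ℕ.<⇒≤ e<t) (t≤k j j<s)) maximal (ℕ.≤-trans (s≤s z≤n) ε<d))
        where
        ε<d : ε j < d
        ε<d = ℕ.+-cancelˡ-< e (ε j) d big

        maximal : MaxDefect u e d
        maximal = attain u-ind meets* max

        d≤ε : d ≤ ε (suc j)
        d≤ε = ε≤ j j<s (meets-grow G G-ind (ℕ.<⇒≤ e<t) (t≤k j j<s) meets*)

        compare : ∀ {i} → i ≤ s → d ≡ ε i → Tri (i < suc j) (i ≡ suc j) (suc j < i) → ⊥
        compare i≤s ≡.refl (tri< i≤j _ _)    = ℕ.<⇒≱ ε<d (stepwise-mono ε ε-step (s≤s⁻¹ i≤j) (ℕ.<⇒≤ j<s))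
        compare i≤s ≡.refl (tri≈ _ ≡.refl _) = proj₂ (proj₂ (defect (suc j) (s≤s z≤n) i≤s)) e e<t maximal
        compare i≤s ≡.refl (tri> _ _ j+1<i)  =
          ℕ.<⇒≱ (ℕ.<-≤-trans (ε-inc (suc j) (ℕ.<-≤-trans j+1<i i≤s)) (stepwise-mono ε ε-step j+1<i i≤s)) d≤ε

        no-value : ¬ Σ ℕ (λ i → 1 ≤ i × i ≤ s × d ≡ ε i)
        no-value (i , _ , i≤s , d≡εi) = compare i≤s d≡εi (ℕ.<-cmp i (suc j))

    weight : ∀ r → 1 ≤ r → r ≤ k → ∀ i → i < s → t i ≤ k ∸ r → k ∸ r < t (suc i) →
             GenRankWeight u r (n ∸ (k ∸ r) ∸ ε i)
    weight r _ _ i i<s lo hi = ≡.subst (GenRankWeight u r) (≡.sym (ℕ.∸-+-assoc n (k ∸ r) (ε i)))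
      (genRankWeight u-ind r (meets-grow G G-ind lo (ℕ.m∸n≤m k r) (attained i (ℕ.<⇒≤ i<s))) (meets-bound i i<s hi))

    -- Duality is used in both directions: from `G` to `H` it turns `T + r` vectors in the space
    -- attaining `ε (suc j)` into an intersection of dimension at least `n - (T + r)`, and from `H`
    -- to `G` it shows that no intersection is larger.
    dual-weight : ∀ {k'} (H : Fin k' → V n) → GenOfDual G H → IndepF (cols H) →
                  ∀ r → r ≤ k' → ∀ j → j < s → ε j < r → r ≤ ε (suc j) →
                  GenRankWeight (cols H) r (r + t (suc j))
    dual-weight {k'} H dual w-ind r r≤k' j j<s ε<r r≤ε =
      ≡.subst (GenRankWeight (cols H) r) (≡.trans (ℕ.m∸[m∸n]≡n T+r≤n) (ℕ.+-comm T r)) (genRankWeight w-ind r lower upper)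
      where
      T = t (suc j)
      k+k'≡n = dual-dimension G-ind dual

      T+r≤n : T + r ≤ n
      T+r≤n = ℕ.≤-trans (ℕ.+-mono-≤ (t≤k j j<s) r≤k') (ℕ.≤-reflexive k+k'≡n)

      shrunk : Meets u T (T + r)
      shrunk = meets-shrink (ε (suc j) ∸ r) (≡.subst (Meets u T) (begin
        T + ε (suc j)                  ≡⟨ ≡.cong (T +_) (ℕ.m∸n+n≡m r≤ε) ⟨
        T + (ε (suc j) ∸ r + r)        ≡⟨ ℕ.+-assoc T _ r ⟨
        T + (ε (suc j) ∸ r) + r        ≡⟨ ≡.cong (_+ r) (ℕ.+-comm T _) ⟩
        ε (suc j) ∸ r + T + r          ≡⟨ ℕ.+-assoc (ε (suc j) ∸ r) T r ⟩
        ε (suc j) ∸ r + (T + r)        ∎) (attained (suc j) j<s))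
        where open ≡.≡-Reasoning

      lower : Meets (cols H) (k' ∸ r) (n ∸ (T + r))
      lower = let e , r+e≡k' , meets = meets-dual H G (G⊥⊆H G-ind dual) T r shrunk in
        ≡.subst (λ e → Meets (cols H) e (n ∸ (T + r)))
          (≡.trans (≡.sym (ℕ.m+n∸m≡n r e)) (≡.cong (_∸ r) r+e≡k')) meets

      upper : ∀ {M} → Meets (cols H) (k' ∸ r) M → M ≤ n ∸ (T + r)
      upper {M} meets = ℕ.≮⇒≥ λ big → absurd big meets (ℕ.m≤n⇒∃[o]m+o≡n (ℕ.≤-trans l≤ (ℕ.<⇒≤ big)))
        where
        l = k' ∸ r

        -- Follows from `T ≤ k`; it lets an `M` that is too large be written as `l + d`, the form
        -- that duality takes.
        l≤ : l ≤ n ∸ (T + r)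
        l≤ = begin
          k' ∸ r              ≡⟨ ≡.cong (_∸ r) (ℕ.m+n∸m≡n k k') ⟨
          k + k' ∸ k ∸ r      ≡⟨ ≡.cong (λ n → n ∸ k ∸ r) k+k'≡n ⟩
          n ∸ k ∸ r           ≡⟨ ℕ.∸-+-assoc n k r ⟩
          n ∸ (k + r)         ≤⟨ ℕ.∸-monoʳ-≤ n (ℕ.+-monoˡ-≤ r (t≤k j j<s)) ⟩
          n ∸ (T + r)         ∎
          where open ℕ.≤-Reasoning

        -- Duality returns a subspace of dimension `e = k - d` with defect at least `r`, above
        -- `ε j`. The excess of `l + d` forces `e < T`, where defects are at most `ε j`.
        no-dual : ∀ d → n ∸ (T + r) < l + d → ¬ Σ ℕ (λ e → d + e ≡ k × Meets u e (n ∸ (l + d)))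
        no-dual d big (e , d+e≡k , meets′) =
          ℕ.<⇒≱ ε<r (ℕ.+-cancelˡ-≤ e r (ε j) (≡.subst (_≤ e + ε j) n∸M≡e+r (meets-bound j j<s e<T meets′)))
          where
          n≡ : n ≡ l + d + (e + r)
          n≡ = begin
            n                    ≡⟨ k+k'≡n ⟨
            k + k'               ≡⟨ ≡.cong₂ _+_ d+e≡k (ℕ.m∸n+n≡m r≤k') ⟨
            d + e + (l + r)      ≡⟨ solve 4 (λ d e l r → d :+ e :+ (l :+ r) := l :+ d :+ (e :+ r)) ≡.refl d e l r ⟩
            l + d + (e + r)      ∎
            where
            open ≡.≡-Reasoning
            open +-*-Solver

          n∸M≡e+r : n ∸ (l + d) ≡ e + r
          n∸M≡e+r = ≡.trans (≡.cong (_∸ (l + d)) n≡) (ℕ.m+n∸m≡n (l + d) (e + r))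

          e<T : e < T
          e<T = ℕ.+-cancelʳ-< r e T (ℕ.+-cancelˡ-< (l + d) (e + r) (T + r) (begin-strict
            l + d + (e + r)              ≡⟨ n≡ ⟨
            n                            ≡⟨ ℕ.m∸n+n≡m T+r≤n ⟨
            n ∸ (T + r) + (T + r)        <⟨ ℕ.+-monoˡ-< (T + r) big ⟩
            l + d + (T + r)              ∎))
            where open ℕ.≤-Reasoning

        absurd : ∀ {M} → n ∸ (T + r) < M → Meets (cols H) l M → ¬ (∃ λ d → l + d ≡ M)
        absurd big meets (d , ≡.refl) = no-dual d big (meets-dual G H (H⊥⊆G G-ind dual) l d meets)

theorem2p14 : ∀ {q m : ℕ} (E : Ext q m) (n k k' : ℕ)
    (G : Fin k → Fin n → Ext.Kr.Carrier E) (H : Fin k' → Fin n → Ext.Kr.Carrier E) →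
    Over.NonDegGen E G → Over.GenOfDual E G H → Over.IndepF E (Over.cols E H) →
    (s : ℕ) (t ε : ℕ → ℕ) →
    t 0 ≡ 0 → ε 0 ≡ 0 → t s ≡ k → ε s ≡ n ∸ k →
    (∀ i → i < s → ε i < ε (suc i)) →
    (∀ i → 1 ≤ i → i ≤ s → t i ≤ k × Over.MaxDefect E (Over.cols E G) (t i) (ε i)
    × (∀ r → r < t i → ¬ Over.MaxDefect E (Over.cols E G) r (ε i))) →
    (∀ r e → r ≤ k → Over.MaxDefect E (Over.cols E G) r e → 0 < e →
    Σ ℕ (λ i → 1 ≤ i × i ≤ s × e ≡ ε i)) →
    ((∀ r → 1 ≤ r → r ≤ k → ∀ i → i < s → t i ≤ k ∸ r → k ∸ r < t (suc i) →
    Over.GenRankWeight E (Over.cols E G) r (n ∸ (k ∸ r) ∸ ε i))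
    × (∀ x → (Σ ℕ (λ r → Σ ℕ (λ d → 1 ≤ r × r ≤ k × Over.GenRankWeight E (Over.cols E G) r d × x ≡ suc n ∸ d)))
    ⇔ (Σ ℕ (λ i → i < s × 1 + ε i + t i ≤ x × x ≤ t (suc i) + ε i))))
    × ((∀ r → 1 ≤ r → r ≤ n ∸ k → ∀ j → j < s → ε j < r → r ≤ ε (suc j) →
    Over.GenRankWeight E (Over.cols E H) r (r + t (suc j)))
    × (∀ x → (Σ ℕ (λ r → Σ ℕ (λ d → 1 ≤ r × r ≤ n ∸ k × Over.GenRankWeight E (Over.cols E H) r d × x ≡ d)))
    ⇔ (Σ ℕ (λ j → j < s × 1 + ε j + t (suc j) ≤ x × x ≤ ε (suc j) + t (suc j)))))
    × (∀ x → (Σ ℕ (λ r → Σ ℕ (λ d → 1 ≤ r × r ≤ n ∸ k × Over.GenRankWeight E (Over.cols E H) r d × x ≡ d)))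
    ⇔ (1 ≤ x × x ≤ n × ¬ Σ ℕ (λ r → Σ ℕ (λ d → 1 ≤ r × r ≤ k × Over.GenRankWeight E (Over.cols E G) r d × x ≡ suc n ∸ d))))
theorem2p14 E n k k' G H (G-ind , u-ind) dual w-ind s t ε t0 ε0 ts εs ε-inc defect complete =
  (weight , I⇔) , (dual-weight′ , J⇔) , λ x →
    (⇔-id (1 ≤ x) ×-⇔ (⇔-id (x ≤ n) ×-⇔ ¬-cong-⇔ (⇔-sym (I⇔ x)))) ⇔-∘ (I.InJ⇔∁InI x ⇔-∘ J⇔ x)
  where
  open Weights E
  open Defects G G-ind u-ind s t ε t0 ε0 ε-inc defect complete

  k+k'≡n : k + k' ≡ n
  k+k'≡n = Systems.dual-dimension E G-ind dual

  module I = Intervals n k s t ε t0 ε0 ts εs (≡.subst (k ≤_) k+k'≡n (ℕ.m≤m+n k k')) t-step ε-step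

  dual-weight′ : ∀ r → 1 ≤ r → r ≤ n ∸ k → ∀ j → j < s → ε j < r → r ≤ ε (suc j) →
                 Over.GenRankWeight E (Over.cols E H) r (r + t (suc j))
  dual-weight′ r _ r≤ = dual-weight H dual w-ind r
    (≡.subst (r ≤_) (≡.trans (≡.cong (_∸ k) (≡.sym k+k'≡n)) (ℕ.m+n∸m≡n k k')) r≤)

  I⇔ = I.weights⇔InI (Over.GenRankWeight E (Over.cols E G)) genRankWeight-unique weight
  J⇔ = I.weights⇔InJ (Over.GenRankWeight E (Over.cols E H)) genRankWeight-unique dual-weight′
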